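{- A pair $(I,J)$ occurs as the pair of invariants $(I(f),J(f))$ of an integral ternary cubic form $f$ if and only if $(I,J)\in\frac1{16}\mathbb{Z}\times\frac1{32}\mathbb{Z}$, the pair $(16I,32J)$ satisfies one of the following conditions: (a) $16I\equiv0\pmod{16}$ and $32J\equiv0\pmod{32}$; (b) $16I\equiv0\pmod{16}$ and $32J\equiv8\pmod{32}$; (c) $16I\equiv1\pmod{64}$ and $32J\equiv31\pmod{32}$; (d) $16I\equiv9\pmod{64}$ and $32J\equiv27\pmod{32}$; (e) $16I\equiv17\pmod{64}$ and $32J\equiv7\pmod{32}$; (f) $16I\equiv25\pmod{64}$ and $32J\equiv3\pmod{32}$; (g) $16I\equiv33\pmod{64}$ and $32J\equiv15\pmod{32}$; (h) $16I\equiv41\pmod{64}$ and $32J\equiv11\pmod{32}$; (i) $16I\equiv49\pmod{64}$ and $32J\equiv23\pmod{32}$; (j) $16I\equiv57\pmod{64}$ and $32J\equiv19\pmod{32}$; and $(I,J)$ satisfies one of the following conditions: (a) $I\equiv0\pmod3$ and $J\equiv0\pmod{27}$; (b) $I\equiv1\pmod9$ and $J\equiv\pm2\pmod{27}$; (c) $I\equiv4\pmod9$ and $J\equiv\pm16\pmod{27}$; (d) $I\equiv7\pmod9$ and $J\equiv\pm7\pmod{27}$.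
   Context: An integral ternary cubic form is $f(x,y,z)=\sum_{i+j+k=3}a_{ijk}x^iy^jz^k$ with $a_{ijk}\in\mathbb{Z}$. The Hessian $\mathcal{H}(f)$ is the determinant of the matrix of second partial derivatives of $f$. $I(f),J(f)$ are the $\mathrm{SL}_3$-invariant polynomials of degrees $4$ and $6$ in the coefficients of $f$ determined by $\mathcal{H}(\mathcal{H}(f))=12288\,I(f)^2f+512\,J(f)\mathcal{H}(f)$, with sign normalized so that $x^3+Axz^2+Bz^3-y^2z$ has $I=-3A$, $J=-27B$. Since $I,J$ have denominators powers of $2$, the congruences modulo $3,9,27$ are understood in $\mathbb{Z}_{(3)}$ (i.e., after inverting $2$). -}

module Defs where

open import Data.Nat using (ℕ)
import Data.Nat.Divisibility as ℕDiv
open import Data.Integer using (ℤ; +_; -_; _+_; _-_; _*_)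
import Data.Integer.Divisibility as ℤDiv
open import Data.Sum using (_⊎_)
open import Data.Rational as ℚ using (ℚ; _/_; ↧ₙ_)
open import Data.Product using (Σ; _×_)
open import Relation.Binary.PropositionalEquality using (_≡_)
open import Relation.Nullary using (¬_)

-- Integral ternary cubic forms
--   f(x,y,z) = Σ_{i+j+k=3} a_{ijk} x^i y^j z^k ,  a_{ijk} ∈ ℤ
-- represented by their ten integer coefficients (field aijk = a_{ijk}).

record TernaryCubic : Set where
  constructor cubic
  field
    a300 a210 a201 a120 a111 a102 a030 a021 a012 a003 : ℤ

-- The invariants I(f), J(f).
--
-- I and J are the SL₃-invariant polynomials of degrees 4 and 6 in the
-- coefficients determined by  H(H(f)) = 12288 I(f)² f + 512 J(f) H(f),
-- H = Hessian, normalized so that x³ + A x z² + B z³ − y² z has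
-- I = −3A, J = −27B.  They are written out explicitly below (computed as
-- the unique-up-to-scalar invariants of degree 4 and 6, normalized on the
-- Weierstrass form, and checked against the Hessian identity).
-- For readability we write the integer polynomials 16·I and 32·J and set
-- I = (16·I)/16, J = (32·J)/32 in ℚ.

sixteenI : TernaryCubic → ℤ
thirtytwoJ : TernaryCubic → ℤ
sixteenI f = let open TernaryCubic f in
      (+ 144) * a300 * a120 * a021 * a003
    + (- (+ 48)) * a300 * a120 * a012 * a012
    + (- (+ 216)) * a300 * a111 * a030 * a003
    + (+ 24) * a300 * a111 * a021 * a012
    + (+ 144) * a300 * a102 * a030 * a012
    + (- (+ 48)) * a300 * a102 * a021 * a021
    + (- (+ 48)) * a210 * a210 * a021 * a003
    + (+ 16) * a210 * a210 * a012 * a012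
    + (+ 144) * a210 * a201 * a030 * a003
    + (- (+ 16)) * a210 * a201 * a021 * a012
    + (+ 24) * a210 * a120 * a111 * a003
    + (- (+ 16)) * a210 * a120 * a102 * a012
    + (- (+ 8)) * a210 * a111 * a111 * a012
    + (+ 24) * a210 * a111 * a102 * a021
    + (- (+ 48)) * a210 * a102 * a102 * a030
    + (- (+ 48)) * a201 * a201 * a030 * a012
    + (+ 16) * a201 * a201 * a021 * a021
    + (- (+ 48)) * a201 * a120 * a120 * a003
    + (+ 24) * a201 * a120 * a111 * a012
    + (- (+ 16)) * a201 * a120 * a102 * a021
    + (- (+ 8)) * a201 * a111 * a111 * a021
    + (+ 24) * a201 * a111 * a102 * a030
    + (+ 16) * a120 * a120 * a102 * a102
    + (- (+ 8)) * a120 * a111 * a111 * a102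
    + (+ 1) * a111 * a111 * a111 * a111

thirtytwoJ f = let open TernaryCubic f in
      (+ 5832) * a300 * a300 * a030 * a030 * a003 * a003
    + (- (+ 3888)) * a300 * a300 * a030 * a021 * a012 * a003
    + (+ 864) * a300 * a300 * a030 * a012 * a012 * a012
    + (+ 864) * a300 * a300 * a021 * a021 * a021 * a003
    + (- (+ 216)) * a300 * a300 * a021 * a021 * a012 * a012
    + (- (+ 3888)) * a300 * a210 * a120 * a030 * a003 * a003
    + (+ 1296) * a300 * a210 * a120 * a021 * a012 * a003
    + (- (+ 288)) * a300 * a210 * a120 * a012 * a012 * a012
    + (+ 1296) * a300 * a210 * a111 * a030 * a012 * a003
    + (- (+ 864)) * a300 * a210 * a111 * a021 * a021 * a003
    + (+ 144) * a300 * a210 * a111 * a021 * a012 * a012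
    + (+ 1296) * a300 * a210 * a102 * a030 * a021 * a003
    + (- (+ 864)) * a300 * a210 * a102 * a030 * a012 * a012
    + (+ 144) * a300 * a210 * a102 * a021 * a021 * a012
    + (+ 1296) * a300 * a201 * a120 * a030 * a012 * a003
    + (- (+ 864)) * a300 * a201 * a120 * a021 * a021 * a003
    + (+ 144) * a300 * a201 * a120 * a021 * a012 * a012
    + (+ 1296) * a300 * a201 * a111 * a030 * a021 * a003
    + (- (+ 864)) * a300 * a201 * a111 * a030 * a012 * a012
    + (+ 144) * a300 * a201 * a111 * a021 * a021 * a012
    + (- (+ 3888)) * a300 * a201 * a102 * a030 * a030 * a003
    + (+ 1296) * a300 * a201 * a102 * a030 * a021 * a012
    + (- (+ 288)) * a300 * a201 * a102 * a021 * a021 * a021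
    + (+ 864) * a300 * a120 * a120 * a120 * a003 * a003
    + (- (+ 864)) * a300 * a120 * a120 * a111 * a012 * a003
    + (- (+ 864)) * a300 * a120 * a120 * a102 * a021 * a003
    + (+ 576) * a300 * a120 * a120 * a102 * a012 * a012
    + (+ 648) * a300 * a120 * a111 * a111 * a021 * a003
    + (+ 72) * a300 * a120 * a111 * a111 * a012 * a012
    + (+ 1296) * a300 * a120 * a111 * a102 * a030 * a003
    + (- (+ 720)) * a300 * a120 * a111 * a102 * a021 * a012
    + (- (+ 864)) * a300 * a120 * a102 * a102 * a030 * a012
    + (+ 576) * a300 * a120 * a102 * a102 * a021 * a021
    + (- (+ 540)) * a300 * a111 * a111 * a111 * a030 * a003
    + (- (+ 36)) * a300 * a111 * a111 * a111 * a021 * a012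
    + (+ 648) * a300 * a111 * a111 * a102 * a030 * a012
    + (+ 72) * a300 * a111 * a111 * a102 * a021 * a021
    + (- (+ 864)) * a300 * a111 * a102 * a102 * a030 * a021
    + (+ 864) * a300 * a102 * a102 * a102 * a030 * a030
    + (+ 864) * a210 * a210 * a210 * a030 * a003 * a003
    + (- (+ 288)) * a210 * a210 * a210 * a021 * a012 * a003
    + (+ 64) * a210 * a210 * a210 * a012 * a012 * a012
    + (- (+ 864)) * a210 * a210 * a201 * a030 * a012 * a003
    + (+ 576) * a210 * a210 * a201 * a021 * a021 * a003
    + (- (+ 96)) * a210 * a210 * a201 * a021 * a012 * a012
    + (- (+ 216)) * a210 * a210 * a120 * a120 * a003 * a003
    + (+ 144) * a210 * a210 * a120 * a111 * a012 * a003
    + (+ 144) * a210 * a210 * a120 * a102 * a021 * a003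
    + (- (+ 96)) * a210 * a210 * a120 * a102 * a012 * a012
    + (+ 72) * a210 * a210 * a111 * a111 * a021 * a003
    + (- (+ 48)) * a210 * a210 * a111 * a111 * a012 * a012
    + (- (+ 864)) * a210 * a210 * a111 * a102 * a030 * a003
    + (+ 144) * a210 * a210 * a111 * a102 * a021 * a012
    + (+ 576) * a210 * a210 * a102 * a102 * a030 * a012
    + (- (+ 216)) * a210 * a210 * a102 * a102 * a021 * a021
    + (- (+ 864)) * a210 * a201 * a201 * a030 * a021 * a003
    + (+ 576) * a210 * a201 * a201 * a030 * a012 * a012
    + (- (+ 96)) * a210 * a201 * a201 * a021 * a021 * a012
    + (+ 144) * a210 * a201 * a120 * a120 * a012 * a003
    + (- (+ 720)) * a210 * a201 * a120 * a111 * a021 * a003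
    + (+ 144) * a210 * a201 * a120 * a111 * a012 * a012
    + (+ 1296) * a210 * a201 * a120 * a102 * a030 * a003
    + (- (+ 48)) * a210 * a201 * a120 * a102 * a021 * a012
    + (+ 648) * a210 * a201 * a111 * a111 * a030 * a003
    + (- (+ 24)) * a210 * a201 * a111 * a111 * a021 * a012
    + (- (+ 720)) * a210 * a201 * a111 * a102 * a030 * a012
    + (+ 144) * a210 * a201 * a111 * a102 * a021 * a021
    + (+ 144) * a210 * a201 * a102 * a102 * a030 * a021
    + (+ 144) * a210 * a120 * a120 * a111 * a102 * a003
    + (- (+ 96)) * a210 * a120 * a120 * a102 * a102 * a012
    + (- (+ 36)) * a210 * a120 * a111 * a111 * a111 * a003
    + (- (+ 24)) * a210 * a120 * a111 * a111 * a102 * a012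
    + (+ 144) * a210 * a120 * a111 * a102 * a102 * a021
    + (- (+ 288)) * a210 * a120 * a102 * a102 * a102 * a030
    + (+ 12) * a210 * a111 * a111 * a111 * a111 * a012
    + (- (+ 36)) * a210 * a111 * a111 * a111 * a102 * a021
    + (+ 72) * a210 * a111 * a111 * a102 * a102 * a030
    + (+ 864) * a201 * a201 * a201 * a030 * a030 * a003
    + (- (+ 288)) * a201 * a201 * a201 * a030 * a021 * a012
    + (+ 64) * a201 * a201 * a201 * a021 * a021 * a021
    + (+ 576) * a201 * a201 * a120 * a120 * a021 * a003
    + (- (+ 216)) * a201 * a201 * a120 * a120 * a012 * a012
    + (- (+ 864)) * a201 * a201 * a120 * a111 * a030 * a003
    + (+ 144) * a201 * a201 * a120 * a111 * a021 * a012
    + (+ 144) * a201 * a201 * a120 * a102 * a030 * a012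
    + (- (+ 96)) * a201 * a201 * a120 * a102 * a021 * a021
    + (+ 72) * a201 * a201 * a111 * a111 * a030 * a012
    + (- (+ 48)) * a201 * a201 * a111 * a111 * a021 * a021
    + (+ 144) * a201 * a201 * a111 * a102 * a030 * a021
    + (- (+ 216)) * a201 * a201 * a102 * a102 * a030 * a030
    + (- (+ 288)) * a201 * a120 * a120 * a120 * a102 * a003
    + (+ 72) * a201 * a120 * a120 * a111 * a111 * a003
    + (+ 144) * a201 * a120 * a120 * a111 * a102 * a012
    + (- (+ 96)) * a201 * a120 * a120 * a102 * a102 * a021
    + (- (+ 36)) * a201 * a120 * a111 * a111 * a111 * a012
    + (- (+ 24)) * a201 * a120 * a111 * a111 * a102 * a021
    + (+ 144) * a201 * a120 * a111 * a102 * a102 * a030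
    + (+ 12) * a201 * a111 * a111 * a111 * a111 * a021
    + (- (+ 36)) * a201 * a111 * a111 * a111 * a102 * a030
    + (+ 64) * a120 * a120 * a120 * a102 * a102 * a102
    + (- (+ 48)) * a120 * a120 * a111 * a111 * a102 * a102
    + (+ 12) * a120 * a111 * a111 * a111 * a111 * a102
    + (- (+ 1)) * a111 * a111 * a111 * a111 * a111 * a111

invI : TernaryCubic → ℚ
invI f = sixteenI f / 16

invJ : TernaryCubic → ℚ
invJ f = thirtytwoJ f / 32

InZ3 : ℚ → Set
InZ3 q = ¬ (3 ℕDiv.∣ ↧ₙ q)

_≡_[modℤ₍₃₎_] : ℚ → ℚ → ℤ → Set
q ≡ r [modℤ₍₃₎ m ] = Σ ℚ (λ u → InZ3 u × (q ℚ.- r ≡ (m / 1) ℚ.* u))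

_≡_[modℤ_] : ℤ → ℤ → ℤ → Set
a ≡ r [modℤ m ] = m ℤDiv.∣ (a - r)

-- The 2-adic conditions (a)–(j) on the pair (16I, 32J) = (i , j).

Cond2 : ℤ → ℤ → Set
Cond2 i j =
     (i ≡ + 0 [modℤ + 16 ] × j ≡ + 0 [modℤ + 32 ])
   ⊎ (i ≡ + 0 [modℤ + 16 ] × j ≡ + 8 [modℤ + 32 ])
   ⊎ (i ≡ + 1 [modℤ + 64 ] × j ≡ + 31 [modℤ + 32 ])
   ⊎ (i ≡ + 9 [modℤ + 64 ] × j ≡ + 27 [modℤ + 32 ])
   ⊎ (i ≡ + 17 [modℤ + 64 ] × j ≡ + 7 [modℤ + 32 ])
   ⊎ (i ≡ + 25 [modℤ + 64 ] × j ≡ + 3 [modℤ + 32 ])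
   ⊎ (i ≡ + 33 [modℤ + 64 ] × j ≡ + 15 [modℤ + 32 ])
   ⊎ (i ≡ + 41 [modℤ + 64 ] × j ≡ + 11 [modℤ + 32 ])
   ⊎ (i ≡ + 49 [modℤ + 64 ] × j ≡ + 23 [modℤ + 32 ])
   ⊎ (i ≡ + 57 [modℤ + 64 ] × j ≡ + 19 [modℤ + 32 ])

ℤ→ℚ : ℤ → ℚ
ℤ→ℚ z = z / 1

Cond3 : ℚ → ℚ → Set
Cond3 I J =
     (I ≡ ℤ→ℚ (+ 0) [modℤ₍₃₎ + 3 ] × J ≡ ℤ→ℚ (+ 0) [modℤ₍₃₎ + 27 ])
   ⊎ (I ≡ ℤ→ℚ (+ 1) [modℤ₍₃₎ + 9 ]
       × (J ≡ ℤ→ℚ (+ 2) [modℤ₍₃₎ + 27 ] ⊎ J ≡ ℤ→ℚ (- + 2) [modℤ₍₃₎ + 27 ]))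
   ⊎ (I ≡ ℤ→ℚ (+ 4) [modℤ₍₃₎ + 9 ]
       × (J ≡ ℤ→ℚ (+ 16) [modℤ₍₃₎ + 27 ] ⊎ J ≡ ℤ→ℚ (- + 16) [modℤ₍₃₎ + 27 ]))
   ⊎ (I ≡ ℤ→ℚ (+ 7) [modℤ₍₃₎ + 9 ]
       × (J ≡ ℤ→ℚ (+ 7) [modℤ₍₃₎ + 27 ] ⊎ J ≡ ℤ→ℚ (- + 7) [modℤ₍₃₎ + 27 ]))

{-# OPTIONS --safe #-}

-- By the formulas of Artin, Rodriguez-Villegas and Tate the pair (16I, 32J) of a
-- ternary cubic is the pair (c₄, c₆) of a Weierstrass equation with integral
-- coefficients, so it suffices to describe the pairs (c₄, c₆).  Put
-- b₂ = a₁² + 4a₂ and b₄ = 2a₄ + a₁a₃.  The residue ε ∈ {0, ±1} of b₂ modulo 3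
-- determines the 3-adic shape of (c₄, c₆), and the parity of a₁ the 2-adic one; for
-- odd a₁ one may take a₁ = 1.  Conversely b₂ = 4ε in the even case and b₂ = 4ε − 3
-- in the odd case lead to a Weierstrass equation with prescribed (c₄, c₆).
module Submission where

open import Defs
open import Data.Empty using (⊥-elim)
open import Data.Fin using (toℕ; fromℕ<)
open import Data.Fin.Patterns
open import Data.Fin.Properties using (toℕ-fromℕ<)
open import Data.Integer using (ℤ; +_; -_; _+_; _-_; _*_; ∣_∣)
open import Data.Integer.Coprimality using (coprime-divisor)
open import Data.Integer.Divisibility.Signed using (divides; ∣ᵤ⇒∣; ∣⇒∣ᵤ)
open import Data.Integer.DivMod using (_/ℕ_; _%ℕ_; n%ℕd<d; a≡a%ℕn+[a/ℕn]*n)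
open import Data.Integer.GCD using (gcd)
import Data.Integer.Properties as ℤₚ
open import Data.Integer.Tactic.RingSolver using (ring; solve-∀)
open import Data.List using (List; []; _∷_; foldr)
open import Data.List.Relation.Unary.All using (All; []; _∷_)
open import Data.Nat as ℕ using (ℕ; suc)
open import Data.Nat.Coprimality as Coprimality using (Coprime)
import Data.Nat.Divisibility as ℕDiv
open import Data.Nat.Primality using (prime?; prime⇒irreducible)
import Data.Nat.Properties as ℕₚ
open import Data.Product using (Σ; ∃-syntax; _×_; _,_)
open import Data.Rational as ℚ using (ℚ; _/_)
import Data.Rational.Properties as ℚₚ
open import Data.Rational.Unnormalised as ℚᵘ using (mkℚᵘ; *≡*)
import Data.Rational.Unnormalised.Properties as ℚᵘₚ
open import Data.Sum using (inj₁; inj₂)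
open import Data.Vec using (Vec; []; _∷_)
open import Function.Bundles using (_⇔_; mk⇔)
open import Relation.Binary.PropositionalEquality
  using (_≡_; refl; sym; trans; cong; cong₂; subst₂; module ≡-Reasoning)
open import Relation.Nullary using (¬_)
open import Relation.Nullary.Decidable using (from-yes; from-no)
open import Tactic.RingSolver.NonReflective ring
  using (Expr; Κ; Ι; _⊕_; _⊗_; ⊝_; module Ops)

-- Weierstrass invariants as reflected polynomials

private
  variable
    n : ℕ

infixl 6 _⊖_

_⊖_ : Expr ℤ n → Expr ℤ n → Expr ℤ n
p ⊖ q = p ⊕ ⊝ q

κ κ⁻ : ℕ → Expr ℤ n
κ k = Κ (+ k)
κ⁻ k = Κ (- + k)

C₄ : (a₁ a₂ a₃ a₄ : Expr ℤ n) → Expr ℤ n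
C₄ a₁ a₂ a₃ a₄ =
  let b₂ = a₁ ⊗ a₁ ⊕ κ 4 ⊗ a₂
      b₄ = κ 2 ⊗ a₄ ⊕ a₁ ⊗ a₃
  in b₂ ⊗ b₂ ⊖ κ 24 ⊗ b₄

C₆ : (a₁ a₂ a₃ a₄ a₆ : Expr ℤ n) → Expr ℤ n
C₆ a₁ a₂ a₃ a₄ a₆ =
  let b₂ = a₁ ⊗ a₁ ⊕ κ 4 ⊗ a₂
      b₄ = κ 2 ⊗ a₄ ⊕ a₁ ⊗ a₃
      b₆ = a₃ ⊗ a₃ ⊕ κ 4 ⊗ a₆
  in ⊝ (b₂ ⊗ b₂ ⊗ b₂) ⊕ κ 36 ⊗ b₂ ⊗ b₄ ⊖ κ 216 ⊗ b₆

-- Opaque, because conversion checking would otherwise unfold nested integer products.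
opaque
  c₄ : (a₁ a₂ a₃ a₄ : ℤ) → ℤ
  c₄ a₁ a₂ a₃ a₄ =
    let b₂ = a₁ * a₁ + + 4 * a₂
        b₄ = + 2 * a₄ + a₁ * a₃
    in b₂ * b₂ - + 24 * b₄

  c₆ : (a₁ a₂ a₃ a₄ a₆ : ℤ) → ℤ
  c₆ a₁ a₂ a₃ a₄ a₆ =
    let b₂ = a₁ * a₁ + + 4 * a₂
        b₄ = + 2 * a₄ + a₁ * a₃
        b₆ = a₃ * a₃ + + 4 * a₆
    in - (b₂ * b₂ * b₂) + + 36 * b₂ * b₄ - + 216 * b₆

  -- Inside the opaque block both sides unfold to the same integer term. Outside it, this equation
  -- and the next are the passage between solver expressions and the sealed `c₄` and `c₆`.
  ⟦C₄⟧ : ∀ (p₁ p₂ p₃ p₄ : Expr ℤ n) ρ →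
         Ops.⟦ C₄ p₁ p₂ p₃ p₄ ⟧ ρ ≡
         c₄ (Ops.⟦ p₁ ⟧ ρ) (Ops.⟦ p₂ ⟧ ρ) (Ops.⟦ p₃ ⟧ ρ) (Ops.⟦ p₄ ⟧ ρ)
  ⟦C₄⟧ p₁ p₂ p₃ p₄ ρ = refl

  ⟦C₆⟧ : ∀ (p₁ p₂ p₃ p₄ p₆ : Expr ℤ n) ρ →
         Ops.⟦ C₆ p₁ p₂ p₃ p₄ p₆ ⟧ ρ ≡
         c₆ (Ops.⟦ p₁ ⟧ ρ) (Ops.⟦ p₂ ⟧ ρ) (Ops.⟦ p₃ ⟧ ρ) (Ops.⟦ p₄ ⟧ ρ) (Ops.⟦ p₆ ⟧ ρ)
  ⟦C₆⟧ p₁ p₂ p₃ p₄ p₆ ρ = refl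

-- The Jacobian of the cubic is y² + a₁₁₁xy + A₃y = x³ + A₂x² + A₄x + A₆.
module JacobianPolynomials (a300 a210 a201 a120 a111 a102 a030 a021 a012 a003 : Expr ℤ n) where

  -- `I₁₆` and `J₃₂` are reflected copies of `sixteenI` and `thirtytwoJ`, to which they evaluate
  -- definitionally. Taking expressions as coefficients, they serve both the generic cubic and the
  -- cubic of a Weierstrass equation.
  I₁₆ J₃₂ A₂ A₃ A₄ A₆ : Expr ℤ n

  I₁₆ =
      κ 144 ⊗ a300 ⊗ a120 ⊗ a021 ⊗ a003
       ⊕ κ⁻ 48 ⊗ a300 ⊗ a120 ⊗ a012 ⊗ a012
       ⊕ κ⁻ 216 ⊗ a300 ⊗ a111 ⊗ a030 ⊗ a003
       ⊕ κ 24 ⊗ a300 ⊗ a111 ⊗ a021 ⊗ a012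
       ⊕ κ 144 ⊗ a300 ⊗ a102 ⊗ a030 ⊗ a012
       ⊕ κ⁻ 48 ⊗ a300 ⊗ a102 ⊗ a021 ⊗ a021
       ⊕ κ⁻ 48 ⊗ a210 ⊗ a210 ⊗ a021 ⊗ a003
       ⊕ κ 16 ⊗ a210 ⊗ a210 ⊗ a012 ⊗ a012
       ⊕ κ 144 ⊗ a210 ⊗ a201 ⊗ a030 ⊗ a003
       ⊕ κ⁻ 16 ⊗ a210 ⊗ a201 ⊗ a021 ⊗ a012
       ⊕ κ 24 ⊗ a210 ⊗ a120 ⊗ a111 ⊗ a003
       ⊕ κ⁻ 16 ⊗ a210 ⊗ a120 ⊗ a102 ⊗ a012
       ⊕ κ⁻ 8 ⊗ a210 ⊗ a111 ⊗ a111 ⊗ a012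
       ⊕ κ 24 ⊗ a210 ⊗ a111 ⊗ a102 ⊗ a021
       ⊕ κ⁻ 48 ⊗ a210 ⊗ a102 ⊗ a102 ⊗ a030
       ⊕ κ⁻ 48 ⊗ a201 ⊗ a201 ⊗ a030 ⊗ a012
       ⊕ κ 16 ⊗ a201 ⊗ a201 ⊗ a021 ⊗ a021
       ⊕ κ⁻ 48 ⊗ a201 ⊗ a120 ⊗ a120 ⊗ a003
       ⊕ κ 24 ⊗ a201 ⊗ a120 ⊗ a111 ⊗ a012
       ⊕ κ⁻ 16 ⊗ a201 ⊗ a120 ⊗ a102 ⊗ a021
       ⊕ κ⁻ 8 ⊗ a201 ⊗ a111 ⊗ a111 ⊗ a021
       ⊕ κ 24 ⊗ a201 ⊗ a111 ⊗ a102 ⊗ a030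
       ⊕ κ 16 ⊗ a120 ⊗ a120 ⊗ a102 ⊗ a102
       ⊕ κ⁻ 8 ⊗ a120 ⊗ a111 ⊗ a111 ⊗ a102
       ⊕ κ 1 ⊗ a111 ⊗ a111 ⊗ a111 ⊗ a111

  J₃₂ =
      κ 5832 ⊗ a300 ⊗ a300 ⊗ a030 ⊗ a030 ⊗ a003 ⊗ a003
       ⊕ κ⁻ 3888 ⊗ a300 ⊗ a300 ⊗ a030 ⊗ a021 ⊗ a012 ⊗ a003
       ⊕ κ 864 ⊗ a300 ⊗ a300 ⊗ a030 ⊗ a012 ⊗ a012 ⊗ a012
       ⊕ κ 864 ⊗ a300 ⊗ a300 ⊗ a021 ⊗ a021 ⊗ a021 ⊗ a003
       ⊕ κ⁻ 216 ⊗ a300 ⊗ a300 ⊗ a021 ⊗ a021 ⊗ a012 ⊗ a012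
       ⊕ κ⁻ 3888 ⊗ a300 ⊗ a210 ⊗ a120 ⊗ a030 ⊗ a003 ⊗ a003
       ⊕ κ 1296 ⊗ a300 ⊗ a210 ⊗ a120 ⊗ a021 ⊗ a012 ⊗ a003
       ⊕ κ⁻ 288 ⊗ a300 ⊗ a210 ⊗ a120 ⊗ a012 ⊗ a012 ⊗ a012
       ⊕ κ 1296 ⊗ a300 ⊗ a210 ⊗ a111 ⊗ a030 ⊗ a012 ⊗ a003
       ⊕ κ⁻ 864 ⊗ a300 ⊗ a210 ⊗ a111 ⊗ a021 ⊗ a021 ⊗ a003
       ⊕ κ 144 ⊗ a300 ⊗ a210 ⊗ a111 ⊗ a021 ⊗ a012 ⊗ a012
       ⊕ κ 1296 ⊗ a300 ⊗ a210 ⊗ a102 ⊗ a030 ⊗ a021 ⊗ a003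
       ⊕ κ⁻ 864 ⊗ a300 ⊗ a210 ⊗ a102 ⊗ a030 ⊗ a012 ⊗ a012
       ⊕ κ 144 ⊗ a300 ⊗ a210 ⊗ a102 ⊗ a021 ⊗ a021 ⊗ a012
       ⊕ κ 1296 ⊗ a300 ⊗ a201 ⊗ a120 ⊗ a030 ⊗ a012 ⊗ a003
       ⊕ κ⁻ 864 ⊗ a300 ⊗ a201 ⊗ a120 ⊗ a021 ⊗ a021 ⊗ a003
       ⊕ κ 144 ⊗ a300 ⊗ a201 ⊗ a120 ⊗ a021 ⊗ a012 ⊗ a012
       ⊕ κ 1296 ⊗ a300 ⊗ a201 ⊗ a111 ⊗ a030 ⊗ a021 ⊗ a003
       ⊕ κ⁻ 864 ⊗ a300 ⊗ a201 ⊗ a111 ⊗ a030 ⊗ a012 ⊗ a012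
       ⊕ κ 144 ⊗ a300 ⊗ a201 ⊗ a111 ⊗ a021 ⊗ a021 ⊗ a012
       ⊕ κ⁻ 3888 ⊗ a300 ⊗ a201 ⊗ a102 ⊗ a030 ⊗ a030 ⊗ a003
       ⊕ κ 1296 ⊗ a300 ⊗ a201 ⊗ a102 ⊗ a030 ⊗ a021 ⊗ a012
       ⊕ κ⁻ 288 ⊗ a300 ⊗ a201 ⊗ a102 ⊗ a021 ⊗ a021 ⊗ a021
       ⊕ κ 864 ⊗ a300 ⊗ a120 ⊗ a120 ⊗ a120 ⊗ a003 ⊗ a003
       ⊕ κ⁻ 864 ⊗ a300 ⊗ a120 ⊗ a120 ⊗ a111 ⊗ a012 ⊗ a003
       ⊕ κ⁻ 864 ⊗ a300 ⊗ a120 ⊗ a120 ⊗ a102 ⊗ a021 ⊗ a003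
       ⊕ κ 576 ⊗ a300 ⊗ a120 ⊗ a120 ⊗ a102 ⊗ a012 ⊗ a012
       ⊕ κ 648 ⊗ a300 ⊗ a120 ⊗ a111 ⊗ a111 ⊗ a021 ⊗ a003
       ⊕ κ 72 ⊗ a300 ⊗ a120 ⊗ a111 ⊗ a111 ⊗ a012 ⊗ a012
       ⊕ κ 1296 ⊗ a300 ⊗ a120 ⊗ a111 ⊗ a102 ⊗ a030 ⊗ a003
       ⊕ κ⁻ 720 ⊗ a300 ⊗ a120 ⊗ a111 ⊗ a102 ⊗ a021 ⊗ a012
       ⊕ κ⁻ 864 ⊗ a300 ⊗ a120 ⊗ a102 ⊗ a102 ⊗ a030 ⊗ a012
       ⊕ κ 576 ⊗ a300 ⊗ a120 ⊗ a102 ⊗ a102 ⊗ a021 ⊗ a021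
       ⊕ κ⁻ 540 ⊗ a300 ⊗ a111 ⊗ a111 ⊗ a111 ⊗ a030 ⊗ a003
       ⊕ κ⁻ 36 ⊗ a300 ⊗ a111 ⊗ a111 ⊗ a111 ⊗ a021 ⊗ a012
       ⊕ κ 648 ⊗ a300 ⊗ a111 ⊗ a111 ⊗ a102 ⊗ a030 ⊗ a012
       ⊕ κ 72 ⊗ a300 ⊗ a111 ⊗ a111 ⊗ a102 ⊗ a021 ⊗ a021
       ⊕ κ⁻ 864 ⊗ a300 ⊗ a111 ⊗ a102 ⊗ a102 ⊗ a030 ⊗ a021
       ⊕ κ 864 ⊗ a300 ⊗ a102 ⊗ a102 ⊗ a102 ⊗ a030 ⊗ a030
       ⊕ κ 864 ⊗ a210 ⊗ a210 ⊗ a210 ⊗ a030 ⊗ a003 ⊗ a003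
       ⊕ κ⁻ 288 ⊗ a210 ⊗ a210 ⊗ a210 ⊗ a021 ⊗ a012 ⊗ a003
       ⊕ κ 64 ⊗ a210 ⊗ a210 ⊗ a210 ⊗ a012 ⊗ a012 ⊗ a012
       ⊕ κ⁻ 864 ⊗ a210 ⊗ a210 ⊗ a201 ⊗ a030 ⊗ a012 ⊗ a003
       ⊕ κ 576 ⊗ a210 ⊗ a210 ⊗ a201 ⊗ a021 ⊗ a021 ⊗ a003
       ⊕ κ⁻ 96 ⊗ a210 ⊗ a210 ⊗ a201 ⊗ a021 ⊗ a012 ⊗ a012
       ⊕ κ⁻ 216 ⊗ a210 ⊗ a210 ⊗ a120 ⊗ a120 ⊗ a003 ⊗ a003
       ⊕ κ 144 ⊗ a210 ⊗ a210 ⊗ a120 ⊗ a111 ⊗ a012 ⊗ a003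
       ⊕ κ 144 ⊗ a210 ⊗ a210 ⊗ a120 ⊗ a102 ⊗ a021 ⊗ a003
       ⊕ κ⁻ 96 ⊗ a210 ⊗ a210 ⊗ a120 ⊗ a102 ⊗ a012 ⊗ a012
       ⊕ κ 72 ⊗ a210 ⊗ a210 ⊗ a111 ⊗ a111 ⊗ a021 ⊗ a003
       ⊕ κ⁻ 48 ⊗ a210 ⊗ a210 ⊗ a111 ⊗ a111 ⊗ a012 ⊗ a012
       ⊕ κ⁻ 864 ⊗ a210 ⊗ a210 ⊗ a111 ⊗ a102 ⊗ a030 ⊗ a003
       ⊕ κ 144 ⊗ a210 ⊗ a210 ⊗ a111 ⊗ a102 ⊗ a021 ⊗ a012
       ⊕ κ 576 ⊗ a210 ⊗ a210 ⊗ a102 ⊗ a102 ⊗ a030 ⊗ a012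
       ⊕ κ⁻ 216 ⊗ a210 ⊗ a210 ⊗ a102 ⊗ a102 ⊗ a021 ⊗ a021
       ⊕ κ⁻ 864 ⊗ a210 ⊗ a201 ⊗ a201 ⊗ a030 ⊗ a021 ⊗ a003
       ⊕ κ 576 ⊗ a210 ⊗ a201 ⊗ a201 ⊗ a030 ⊗ a012 ⊗ a012
       ⊕ κ⁻ 96 ⊗ a210 ⊗ a201 ⊗ a201 ⊗ a021 ⊗ a021 ⊗ a012
       ⊕ κ 144 ⊗ a210 ⊗ a201 ⊗ a120 ⊗ a120 ⊗ a012 ⊗ a003
       ⊕ κ⁻ 720 ⊗ a210 ⊗ a201 ⊗ a120 ⊗ a111 ⊗ a021 ⊗ a003
       ⊕ κ 144 ⊗ a210 ⊗ a201 ⊗ a120 ⊗ a111 ⊗ a012 ⊗ a012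
       ⊕ κ 1296 ⊗ a210 ⊗ a201 ⊗ a120 ⊗ a102 ⊗ a030 ⊗ a003
       ⊕ κ⁻ 48 ⊗ a210 ⊗ a201 ⊗ a120 ⊗ a102 ⊗ a021 ⊗ a012
       ⊕ κ 648 ⊗ a210 ⊗ a201 ⊗ a111 ⊗ a111 ⊗ a030 ⊗ a003
       ⊕ κ⁻ 24 ⊗ a210 ⊗ a201 ⊗ a111 ⊗ a111 ⊗ a021 ⊗ a012
       ⊕ κ⁻ 720 ⊗ a210 ⊗ a201 ⊗ a111 ⊗ a102 ⊗ a030 ⊗ a012
       ⊕ κ 144 ⊗ a210 ⊗ a201 ⊗ a111 ⊗ a102 ⊗ a021 ⊗ a021
       ⊕ κ 144 ⊗ a210 ⊗ a201 ⊗ a102 ⊗ a102 ⊗ a030 ⊗ a021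
       ⊕ κ 144 ⊗ a210 ⊗ a120 ⊗ a120 ⊗ a111 ⊗ a102 ⊗ a003
       ⊕ κ⁻ 96 ⊗ a210 ⊗ a120 ⊗ a120 ⊗ a102 ⊗ a102 ⊗ a012
       ⊕ κ⁻ 36 ⊗ a210 ⊗ a120 ⊗ a111 ⊗ a111 ⊗ a111 ⊗ a003
       ⊕ κ⁻ 24 ⊗ a210 ⊗ a120 ⊗ a111 ⊗ a111 ⊗ a102 ⊗ a012
       ⊕ κ 144 ⊗ a210 ⊗ a120 ⊗ a111 ⊗ a102 ⊗ a102 ⊗ a021
       ⊕ κ⁻ 288 ⊗ a210 ⊗ a120 ⊗ a102 ⊗ a102 ⊗ a102 ⊗ a030
       ⊕ κ 12 ⊗ a210 ⊗ a111 ⊗ a111 ⊗ a111 ⊗ a111 ⊗ a012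
       ⊕ κ⁻ 36 ⊗ a210 ⊗ a111 ⊗ a111 ⊗ a111 ⊗ a102 ⊗ a021
       ⊕ κ 72 ⊗ a210 ⊗ a111 ⊗ a111 ⊗ a102 ⊗ a102 ⊗ a030
       ⊕ κ 864 ⊗ a201 ⊗ a201 ⊗ a201 ⊗ a030 ⊗ a030 ⊗ a003
       ⊕ κ⁻ 288 ⊗ a201 ⊗ a201 ⊗ a201 ⊗ a030 ⊗ a021 ⊗ a012
       ⊕ κ 64 ⊗ a201 ⊗ a201 ⊗ a201 ⊗ a021 ⊗ a021 ⊗ a021
       ⊕ κ 576 ⊗ a201 ⊗ a201 ⊗ a120 ⊗ a120 ⊗ a021 ⊗ a003
       ⊕ κ⁻ 216 ⊗ a201 ⊗ a201 ⊗ a120 ⊗ a120 ⊗ a012 ⊗ a012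
       ⊕ κ⁻ 864 ⊗ a201 ⊗ a201 ⊗ a120 ⊗ a111 ⊗ a030 ⊗ a003
       ⊕ κ 144 ⊗ a201 ⊗ a201 ⊗ a120 ⊗ a111 ⊗ a021 ⊗ a012
       ⊕ κ 144 ⊗ a201 ⊗ a201 ⊗ a120 ⊗ a102 ⊗ a030 ⊗ a012
       ⊕ κ⁻ 96 ⊗ a201 ⊗ a201 ⊗ a120 ⊗ a102 ⊗ a021 ⊗ a021
       ⊕ κ 72 ⊗ a201 ⊗ a201 ⊗ a111 ⊗ a111 ⊗ a030 ⊗ a012
       ⊕ κ⁻ 48 ⊗ a201 ⊗ a201 ⊗ a111 ⊗ a111 ⊗ a021 ⊗ a021
       ⊕ κ 144 ⊗ a201 ⊗ a201 ⊗ a111 ⊗ a102 ⊗ a030 ⊗ a021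
       ⊕ κ⁻ 216 ⊗ a201 ⊗ a201 ⊗ a102 ⊗ a102 ⊗ a030 ⊗ a030
       ⊕ κ⁻ 288 ⊗ a201 ⊗ a120 ⊗ a120 ⊗ a120 ⊗ a102 ⊗ a003
       ⊕ κ 72 ⊗ a201 ⊗ a120 ⊗ a120 ⊗ a111 ⊗ a111 ⊗ a003
       ⊕ κ 144 ⊗ a201 ⊗ a120 ⊗ a120 ⊗ a111 ⊗ a102 ⊗ a012
       ⊕ κ⁻ 96 ⊗ a201 ⊗ a120 ⊗ a120 ⊗ a102 ⊗ a102 ⊗ a021
       ⊕ κ⁻ 36 ⊗ a201 ⊗ a120 ⊗ a111 ⊗ a111 ⊗ a111 ⊗ a012
       ⊕ κ⁻ 24 ⊗ a201 ⊗ a120 ⊗ a111 ⊗ a111 ⊗ a102 ⊗ a021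
       ⊕ κ 144 ⊗ a201 ⊗ a120 ⊗ a111 ⊗ a102 ⊗ a102 ⊗ a030
       ⊕ κ 12 ⊗ a201 ⊗ a111 ⊗ a111 ⊗ a111 ⊗ a111 ⊗ a021
       ⊕ κ⁻ 36 ⊗ a201 ⊗ a111 ⊗ a111 ⊗ a111 ⊗ a102 ⊗ a030
       ⊕ κ 64 ⊗ a120 ⊗ a120 ⊗ a120 ⊗ a102 ⊗ a102 ⊗ a102
       ⊕ κ⁻ 48 ⊗ a120 ⊗ a120 ⊗ a111 ⊗ a111 ⊗ a102 ⊗ a102
       ⊕ κ 12 ⊗ a120 ⊗ a111 ⊗ a111 ⊗ a111 ⊗ a111 ⊗ a102
       ⊕ κ⁻ 1 ⊗ a111 ⊗ a111 ⊗ a111 ⊗ a111 ⊗ a111 ⊗ a111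

  A₂ =
      ⊝ (a210 ⊗ a012) ⊖ a201 ⊗ a021
       ⊖ a120 ⊗ a102

  A₃ =
      κ 9 ⊗ a300 ⊗ a030 ⊗ a003 ⊖ a300 ⊗ a021 ⊗ a012
       ⊖ a210 ⊗ a120 ⊗ a003 ⊖ a210 ⊗ a102 ⊗ a021
       ⊖ a201 ⊗ a120 ⊗ a012 ⊖ a201 ⊗ a102 ⊗ a030

  A₄ =
      ⊝ (κ 3 ⊗ a300 ⊗ a120 ⊗ a021 ⊗ a003) ⊕ a300 ⊗ a120 ⊗ a012 ⊗ a012
       ⊖ κ 3 ⊗ a300 ⊗ a102 ⊗ a030 ⊗ a012 ⊕ a300 ⊗ a102 ⊗ a021 ⊗ a021
       ⊕ a210 ⊗ a210 ⊗ a021 ⊗ a003 ⊖ κ 3 ⊗ a210 ⊗ a201 ⊗ a030 ⊗ a003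
       ⊕ a210 ⊗ a201 ⊗ a021 ⊗ a012 ⊕ a210 ⊗ a120 ⊗ a102 ⊗ a012
       ⊕ a210 ⊗ a102 ⊗ a102 ⊗ a030 ⊕ a201 ⊗ a201 ⊗ a030 ⊗ a012
       ⊕ a201 ⊗ a120 ⊗ a120 ⊗ a003 ⊕ a201 ⊗ a120 ⊗ a102 ⊗ a021

  A₆ =
      ⊝ (κ 27 ⊗ a300 ⊗ a300 ⊗ a030 ⊗ a030 ⊗ a003 ⊗ a003)
       ⊕ κ 9 ⊗ a300 ⊗ a300 ⊗ a030 ⊗ a021 ⊗ a012 ⊗ a003
       ⊖ a300 ⊗ a300 ⊗ a030 ⊗ a012 ⊗ a012 ⊗ a012
       ⊖ a300 ⊗ a300 ⊗ a021 ⊗ a021 ⊗ a021 ⊗ a003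
       ⊕ κ 9 ⊗ a300 ⊗ a210 ⊗ a120 ⊗ a030 ⊗ a003 ⊗ a003
       ⊖ a300 ⊗ a210 ⊗ a120 ⊗ a021 ⊗ a012 ⊗ a003
       ⊖ κ 3 ⊗ a300 ⊗ a210 ⊗ a111 ⊗ a030 ⊗ a012 ⊗ a003
       ⊕ a300 ⊗ a210 ⊗ a111 ⊗ a021 ⊗ a021 ⊗ a003
       ⊕ κ 3 ⊗ a300 ⊗ a210 ⊗ a102 ⊗ a030 ⊗ a021 ⊗ a003
       ⊕ κ 2 ⊗ a300 ⊗ a210 ⊗ a102 ⊗ a030 ⊗ a012 ⊗ a012
       ⊖ a300 ⊗ a210 ⊗ a102 ⊗ a021 ⊗ a021 ⊗ a012
       ⊕ κ 3 ⊗ a300 ⊗ a201 ⊗ a120 ⊗ a030 ⊗ a012 ⊗ a003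
       ⊕ κ 2 ⊗ a300 ⊗ a201 ⊗ a120 ⊗ a021 ⊗ a021 ⊗ a003
       ⊖ a300 ⊗ a201 ⊗ a120 ⊗ a021 ⊗ a012 ⊗ a012
       ⊖ κ 3 ⊗ a300 ⊗ a201 ⊗ a111 ⊗ a030 ⊗ a021 ⊗ a003
       ⊕ a300 ⊗ a201 ⊗ a111 ⊗ a030 ⊗ a012 ⊗ a012
       ⊕ κ 9 ⊗ a300 ⊗ a201 ⊗ a102 ⊗ a030 ⊗ a030 ⊗ a003
       ⊖ a300 ⊗ a201 ⊗ a102 ⊗ a030 ⊗ a021 ⊗ a012
       ⊖ a300 ⊗ a120 ⊗ a120 ⊗ a120 ⊗ a003 ⊗ a003
       ⊕ a300 ⊗ a120 ⊗ a120 ⊗ a111 ⊗ a012 ⊗ a003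
       ⊕ κ 2 ⊗ a300 ⊗ a120 ⊗ a120 ⊗ a102 ⊗ a021 ⊗ a003
       ⊖ a300 ⊗ a120 ⊗ a120 ⊗ a102 ⊗ a012 ⊗ a012
       ⊖ a300 ⊗ a120 ⊗ a111 ⊗ a111 ⊗ a021 ⊗ a003
       ⊖ κ 3 ⊗ a300 ⊗ a120 ⊗ a111 ⊗ a102 ⊗ a030 ⊗ a003
       ⊕ a300 ⊗ a120 ⊗ a111 ⊗ a102 ⊗ a021 ⊗ a012
       ⊕ κ 2 ⊗ a300 ⊗ a120 ⊗ a102 ⊗ a102 ⊗ a030 ⊗ a012
       ⊖ a300 ⊗ a120 ⊗ a102 ⊗ a102 ⊗ a021 ⊗ a021
       ⊕ a300 ⊗ a111 ⊗ a111 ⊗ a111 ⊗ a030 ⊗ a003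
       ⊖ a300 ⊗ a111 ⊗ a111 ⊗ a102 ⊗ a030 ⊗ a012
       ⊕ a300 ⊗ a111 ⊗ a102 ⊗ a102 ⊗ a030 ⊗ a021
       ⊖ a300 ⊗ a102 ⊗ a102 ⊗ a102 ⊗ a030 ⊗ a030
       ⊖ a210 ⊗ a210 ⊗ a210 ⊗ a030 ⊗ a003 ⊗ a003
       ⊕ κ 2 ⊗ a210 ⊗ a210 ⊗ a201 ⊗ a030 ⊗ a012 ⊗ a003
       ⊖ a210 ⊗ a210 ⊗ a201 ⊗ a021 ⊗ a021 ⊗ a003
       ⊖ a210 ⊗ a210 ⊗ a120 ⊗ a102 ⊗ a021 ⊗ a003
       ⊕ a210 ⊗ a210 ⊗ a111 ⊗ a102 ⊗ a030 ⊗ a003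
       ⊖ a210 ⊗ a210 ⊗ a102 ⊗ a102 ⊗ a030 ⊗ a012
       ⊕ κ 2 ⊗ a210 ⊗ a201 ⊗ a201 ⊗ a030 ⊗ a021 ⊗ a003
       ⊖ a210 ⊗ a201 ⊗ a201 ⊗ a030 ⊗ a012 ⊗ a012
       ⊖ a210 ⊗ a201 ⊗ a120 ⊗ a120 ⊗ a012 ⊗ a003
       ⊕ a210 ⊗ a201 ⊗ a120 ⊗ a111 ⊗ a021 ⊗ a003
       ⊖ a210 ⊗ a201 ⊗ a120 ⊗ a102 ⊗ a030 ⊗ a003
       ⊖ a210 ⊗ a201 ⊗ a120 ⊗ a102 ⊗ a021 ⊗ a012
       ⊖ a210 ⊗ a201 ⊗ a111 ⊗ a111 ⊗ a030 ⊗ a003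
       ⊕ a210 ⊗ a201 ⊗ a111 ⊗ a102 ⊗ a030 ⊗ a012
       ⊖ a210 ⊗ a201 ⊗ a102 ⊗ a102 ⊗ a030 ⊗ a021
       ⊖ a201 ⊗ a201 ⊗ a201 ⊗ a030 ⊗ a030 ⊗ a003
       ⊖ a201 ⊗ a201 ⊗ a120 ⊗ a120 ⊗ a021 ⊗ a003
       ⊕ a201 ⊗ a201 ⊗ a120 ⊗ a111 ⊗ a030 ⊗ a003
       ⊖ a201 ⊗ a201 ⊗ a120 ⊗ a102 ⊗ a030 ⊗ a012

-- Integer identities modulo given equations

-- A list of multiples is a certificate of ideal membership: it exhibits a difference of two
-- polynomials as a combination of relations `left ≈ right` with explicit cofactors.
record Multiple (n : ℕ) : Set where
  constructor _×[_≈_]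
  field
    factor left right : Expr ℤ n

_⊕*_ : Expr ℤ n → List (Multiple n) → Expr ℤ n
p ⊕* ms = foldr (λ (c ×[ l ≈ r ]) q → q ⊕ c ⊗ (l ⊖ r)) p ms

Holds : Vec ℤ n → Multiple n → Set
Holds ρ (_ ×[ l ≈ r ]) = Ops.⟦ l ⟧ ρ ≡ Ops.⟦ r ⟧ ρ

⊕*-vanishing : ∀ (p : Expr ℤ n) ms ρ → All (Holds ρ) ms → Ops.⟦ p ⊕* ms ⟧ ρ ≡ Ops.⟦ p ⟧ ρ
⊕*-vanishing p [] ρ [] = refl
⊕*-vanishing p (c ×[ l ≈ r ] ∷ ms) ρ (l≡r ∷ hs) = begin
  Ops.⟦ p ⊕* ms ⟧ ρ + ⟦c⟧ * (Ops.⟦ l ⟧ ρ - Ops.⟦ r ⟧ ρ)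
    ≡⟨ cong (λ d → Ops.⟦ p ⊕* ms ⟧ ρ + ⟦c⟧ * d) (ℤₚ.i≡j⇒i-j≡0 l≡r) ⟩
  Ops.⟦ p ⊕* ms ⟧ ρ + ⟦c⟧ * + 0   ≡⟨ cong (λ d → Ops.⟦ p ⊕* ms ⟧ ρ + d) (ℤₚ.*-zeroʳ ⟦c⟧) ⟩
  Ops.⟦ p ⊕* ms ⟧ ρ + + 0         ≡⟨ ℤₚ.+-identityʳ _ ⟩
  Ops.⟦ p ⊕* ms ⟧ ρ               ≡⟨ ⊕*-vanishing p ms ρ hs ⟩
  Ops.⟦ p ⟧ ρ                     ∎
  where
  open ≡-Reasoning
  ⟦c⟧ = Ops.⟦ c ⟧ ρ

-- Comparing closed normal forms is much faster than the solver's own check, which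
-- evaluates both sides at variables.
modulo : ∀ (p q : Expr ℤ n) ms → Ops.norm (p ⊖ (q ⊕* ms)) ≡ Ops.norm {n} (κ 0) →
         ∀ ρ → All (Holds ρ) ms → Ops.⟦ p ⟧ ρ ≡ Ops.⟦ q ⟧ ρ
modulo p q ms eq ρ hs = trans (ℤₚ.i-j≡0⇒i≡j _ _ (begin
  Ops.⟦ p ⊖ (q ⊕* ms) ⟧ ρ   ≡⟨ Ops.correct (p ⊖ (q ⊕* ms)) ρ ⟨
  Ops.⟦ p ⊖ (q ⊕* ms) ⇓⟧ ρ  ≡⟨ normal-forms eq ⟩
  Ops.⟦ κ 0 ⇓⟧ ρ            ≡⟨ Ops.correct (κ 0) ρ ⟩
  + 0                       ∎))
  (⊕*-vanishing q ms ρ hs)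
  where
  open ≡-Reasoning
  normal-forms : Ops.norm (p ⊖ (q ⊕* ms)) ≡ Ops.norm (κ 0) →
                 Ops.⟦ p ⊖ (q ⊕* ms) ⇓⟧ ρ ≡ Ops.⟦ κ 0 ⇓⟧ ρ
  normal-forms eq rewrite eq = refl

-- Ternary cubics and Weierstrass equations

-- With a₁ the coefficient of xyz, both equalities are identities in the polynomial ring over the
-- ten coefficients, so the certificates are empty.
sixteenI-thirtytwoJ-weierstrass : ∀ f → ∃[ a₁ ] ∃[ a₂ ] ∃[ a₃ ] ∃[ a₄ ] ∃[ a₆ ]
  sixteenI f ≡ c₄ a₁ a₂ a₃ a₄ × thirtytwoJ f ≡ c₆ a₁ a₂ a₃ a₄ a₆
sixteenI-thirtytwoJ-weierstrass (cubic a b c d e f g h i j) =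
  Ops.⟦ a₁ ⟧ ρ , Ops.⟦ a₂ ⟧ ρ , Ops.⟦ a₃ ⟧ ρ , Ops.⟦ a₄ ⟧ ρ , Ops.⟦ a₆ ⟧ ρ ,
  trans (modulo i₁₆ (C₄ a₁ a₂ a₃ a₄) [] refl ρ []) (⟦C₄⟧ a₁ a₂ a₃ a₄ ρ) ,
  trans (modulo j₃₂ (C₆ a₁ a₂ a₃ a₄ a₆) [] refl ρ []) (⟦C₆⟧ a₁ a₂ a₃ a₄ a₆ ρ)
  where
  ρ : Vec ℤ 10
  ρ = a ∷ b ∷ c ∷ d ∷ e ∷ f ∷ g ∷ h ∷ i ∷ j ∷ []
  open JacobianPolynomials {10} (Ι 0F) (Ι 1F) (Ι 2F) (Ι 3F) (Ι 4F) (Ι 5F) (Ι 6F) (Ι 7F) (Ι 8F) (Ι 9F)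
    renaming (I₁₆ to i₁₆; J₃₂ to j₃₂; A₂ to a₂; A₃ to a₃; A₄ to a₄; A₆ to a₆)
  a₁ : Expr ℤ 10
  a₁ = Ι 4F

-- The form x³ + a₂x²z + a₄xz² + a₆z³ - y²z - a₁xyz - a₃yz². Its sign matches the normalisation of I
-- and J on x³ + Axz² + Bz³ - y²z.
weierstrassCubic : (a₁ a₂ a₃ a₄ a₆ : ℤ) → TernaryCubic
weierstrassCubic a₁ a₂ a₃ a₄ a₆ =
  cubic (+ 1) (+ 0) a₂ (+ 0) (- a₁) a₄ (+ 0) (- + 1) (- a₃) a₆

module _ (a₁ a₂ a₃ a₄ a₆ : ℤ) where
  private
    ρ : Vec ℤ 5
    ρ = a₁ ∷ a₂ ∷ a₃ ∷ a₄ ∷ a₆ ∷ []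
    x₁ x₂ x₃ x₄ x₆ : Expr ℤ 5
    x₁ = Ι 0F
    x₂ = Ι 1F
    x₃ = Ι 2F
    x₄ = Ι 3F
    x₆ = Ι 4F
    open JacobianPolynomials {5} (κ 1) (κ 0) x₂ (κ 0) (⊝ x₁) x₄ (κ 0) (κ⁻ 1) (⊝ x₃) x₆

  sixteenI-weierstrassCubic : sixteenI (weierstrassCubic a₁ a₂ a₃ a₄ a₆) ≡ c₄ a₁ a₂ a₃ a₄
  sixteenI-weierstrassCubic =
    trans (modulo I₁₆ (C₄ x₁ x₂ x₃ x₄) [] refl ρ []) (⟦C₄⟧ x₁ x₂ x₃ x₄ ρ)

  thirtytwoJ-weierstrassCubic : thirtytwoJ (weierstrassCubic a₁ a₂ a₃ a₄ a₆) ≡ c₆ a₁ a₂ a₃ a₄ a₆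
  thirtytwoJ-weierstrassCubic =
    trans (modulo J₃₂ (C₆ x₁ x₂ x₃ x₄ x₆) [] refl ρ []) (⟦C₆⟧ x₁ x₂ x₃ x₄ x₆ ρ)

-- Shapes of (c₄, c₆) modulo powers of 2 and 3

-- In the odd case 1 + 12k + 24k² is the binomial series of (1 + 8k)^(3/2) modulo 32, so the
-- condition says j ≡ -i^(3/2) for the 2-adic root with √i ≡ 1 modulo 4.
data TwoAdic (i j : ℤ) : Set where
  even : ∀ p q a → i ≡ + 16 * p → j ≡ + 32 * q + + 8 * (a * a) → TwoAdic i j
  odd  : ∀ k n → i ≡ + 1 + + 8 * k →
         j ≡ + 32 * n - (+ 1 + + 12 * k + + 24 * (k * k)) → TwoAdic i j

-- With symmetric residues modulo 3, ε³ = ε holds in ℤ itself and can be used as a relation in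
-- certificates.
data Trit : ℤ → Set where
  zeroᵗ : Trit (+ 0)
  oneᵗ  : Trit (+ 1)
  negᵗ  : Trit (- + 1)

-- For ε = ±1, i = 1 + 3e and 1 - 9e is i^(3/2) modulo 27 (as 1/2 ≡ -1 modulo 3), so j ≡ -ε i^(3/2).
-- For ε = 0 the condition is 3 ∣ i and 27 ∣ j.
data ThreeAdic (i j : ℤ) : Set where
  threeAdic : ∀ {ε} → Trit ε → ∀ e v → i ≡ ε * ε + + 3 * e →
              j ≡ + 27 * v - ε * (+ 1 - + 9 * e) → ThreeAdic i j

trit-cube : ∀ {ε} → Trit ε → ε * ε * ε ≡ ε
trit-cube zeroᵗ = refl
trit-cube oneᵗ  = refl
trit-cube negᵗ  = refl

residue : ∀ d .{{_ : ℕ.NonZero d}} (z : ℤ) → ∃[ r ] ∃[ q ] z ≡ + toℕ {d} r + + d * q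
residue d z = fromℕ< (n%ℕd<d z d) , z /ℕ d , (begin
  z                                                ≡⟨ a≡a%ℕn+[a/ℕn]*n z d ⟩
  + (z %ℕ d) + (z /ℕ d) * + d                      ≡⟨ cong₂ (λ r s → + r + s)
                                                         (sym (toℕ-fromℕ< (n%ℕd<d z d)))
                                                         (ℤₚ.*-comm (z /ℕ d) (+ d)) ⟩
  + toℕ (fromℕ< (n%ℕd<d z d)) + + d * (z /ℕ d)     ∎)
  where open ≡-Reasoning

trit-residue : ∀ z → ∃[ ε ] ∃[ w ] (Trit ε × z ≡ ε + + 3 * w)
trit-residue z with residue 3 z
... | 0F , w , eq = + 0 , w , zeroᵗ , eq
... | 1F , w , eq = + 1 , w , oneᵗ , eq
... | 2F , w , eq = - + 1 , + 1 + w , negᵗ , trans eq (shift w)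
  where
  shift : ∀ w → + 2 + + 3 * w ≡ - + 1 + + 3 * (+ 1 + w)
  shift = solve-∀

weierstrass-twoAdic : ∀ a₁ a₂ a₃ a₄ a₆ → TwoAdic (c₄ a₁ a₂ a₃ a₄) (c₆ a₁ a₂ a₃ a₄ a₆)
weierstrass-twoAdic a₁ a₂ a₃ a₄ a₆ with residue 2 a₁
-- For a₁ = 2t, b₂ = 4u and b₄ = 2v. The only term of c₆ not visibly divisible by 32 is -216a₃² =
-- 8a₃² - 7 · 32a₃².
... | 0F , t , refl = even (Ops.⟦ p ⟧ ρ) (Ops.⟦ q ⟧ ρ) a₃
  (trans (sym (⟦C₄⟧ (κ 0 ⊕ κ 2 ⊗ τ) x₂ x₃ x₄ ρ))
    (modulo (C₄ (κ 0 ⊕ κ 2 ⊗ τ) x₂ x₃ x₄) (κ 16 ⊗ p) [] refl ρ []))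
  (trans (sym (⟦C₆⟧ (κ 0 ⊕ κ 2 ⊗ τ) x₂ x₃ x₄ x₆ ρ))
    (modulo (C₆ (κ 0 ⊕ κ 2 ⊗ τ) x₂ x₃ x₄ x₆) (κ 32 ⊗ q ⊕ κ 8 ⊗ (x₃ ⊗ x₃)) [] refl ρ []))
  where
  ρ : Vec ℤ 5
  ρ = t ∷ a₂ ∷ a₃ ∷ a₄ ∷ a₆ ∷ []
  τ x₂ x₃ x₄ x₆ u v p q : Expr ℤ 5
  τ  = Ι 0F
  x₂ = Ι 1F
  x₃ = Ι 2F
  x₄ = Ι 3F
  x₆ = Ι 4F
  u  = τ ⊗ τ ⊕ x₂
  v  = x₄ ⊕ τ ⊗ x₃
  p  = u ⊗ u ⊖ κ 3 ⊗ v
  q  = κ 9 ⊗ u ⊗ v ⊖ κ 2 ⊗ u ⊗ u ⊗ u ⊖ κ 7 ⊗ x₃ ⊗ x₃ ⊖ κ 27 ⊗ x₆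
-- For a₁ = 1 + 2t, b₂ = 1 + 4s and b₄ = 2v + a₃. Comparing c₆ with -(1 + 12k + 24k²) leaves 216(b₄²
-- - a₃²), and b₄² - a₃² = 4(v² + va₃) makes this divisible by 32.
... | 1F , t , refl = odd (Ops.⟦ k ⟧ ρ) (Ops.⟦ m ⟧ ρ)
  (trans (sym (⟦C₄⟧ (κ 1 ⊕ κ 2 ⊗ τ) x₂ x₃ x₄ ρ))
    (modulo (C₄ (κ 1 ⊕ κ 2 ⊗ τ) x₂ x₃ x₄) (κ 1 ⊕ κ 8 ⊗ k) [] refl ρ []))
  (trans (sym (⟦C₆⟧ (κ 1 ⊕ κ 2 ⊗ τ) x₂ x₃ x₄ x₆ ρ))
    (modulo (C₆ (κ 1 ⊕ κ 2 ⊗ τ) x₂ x₃ x₄ x₆)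
      (κ 32 ⊗ m ⊖ (κ 1 ⊕ κ 12 ⊗ k ⊕ κ 24 ⊗ (k ⊗ k))) [] refl ρ []))
  where
  ρ : Vec ℤ 5
  ρ = t ∷ a₂ ∷ a₃ ∷ a₄ ∷ a₆ ∷ []
  τ x₂ x₃ x₄ x₆ s v b₄ k m : Expr ℤ 5
  τ  = Ι 0F
  x₂ = Ι 1F
  x₃ = Ι 2F
  x₄ = Ι 3F
  x₆ = Ι 4F
  s  = τ ⊗ τ ⊕ τ ⊕ x₂
  v  = x₄ ⊕ τ ⊗ x₃
  b₄ = κ 2 ⊗ v ⊕ x₃
  k  = s ⊕ κ 2 ⊗ s ⊗ s ⊖ κ 3 ⊗ b₄
  m  = s ⊗ s ⊗ s ⊕ κ 3 ⊗ s ⊗ s ⊗ s ⊗ s ⊖ κ 9 ⊗ s ⊗ s ⊗ b₄ ⊕ κ 27 ⊗ (v ⊗ v ⊕ v ⊗ x₃ ⊖ x₆)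

-- With b₂ = ε + 3w, c₆ ≡ -ε - 9ε²w + 9εb₄ modulo 27. Since e ≡ 2εw - 8b₄ modulo 3, this equals -ε(1
-- - 9e) modulo 27.
weierstrass-threeAdic : ∀ a₁ a₂ a₃ a₄ a₆ → ThreeAdic (c₄ a₁ a₂ a₃ a₄) (c₆ a₁ a₂ a₃ a₄ a₆)
weierstrass-threeAdic a₁ a₂ a₃ a₄ a₆ with trit-residue (a₁ * a₁ + + 4 * a₂)
... | ε , w , t , eq = threeAdic t (Ops.⟦ e ⟧ ρ) (Ops.⟦ v ⟧ ρ)
  (trans (sym (⟦C₄⟧ x₁ x₂ x₃ x₄ ρ))
    (modulo (C₄ x₁ x₂ x₃ x₄) (η ⊗ η ⊕ κ 3 ⊗ e)
      ((b₂ ⊕ β) ×[ b₂ ≈ β ] ∷ []) refl ρ (eq ∷ [])))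
  (trans (sym (⟦C₆⟧ x₁ x₂ x₃ x₄ x₆ ρ))
    (modulo (C₆ x₁ x₂ x₃ x₄ x₆) (κ 27 ⊗ v ⊖ η ⊗ (κ 1 ⊖ κ 9 ⊗ e))
      -- Replacing b₂ by β in -b₂³ + 36b₂b₄ costs this cofactor times b₂ - β. The second relation
      -- then turns -ε³ into -ε.
      ((κ 36 ⊗ b₄ ⊖ (b₂ ⊗ b₂ ⊕ b₂ ⊗ β ⊕ β ⊗ β)) ×[ b₂ ≈ β ]
        ∷ κ⁻ 1 ×[ η ⊗ η ⊗ η ≈ η ] ∷ []) refl ρ (eq ∷ trit-cube t ∷ [])))
  where
  ρ : Vec ℤ 7
  ρ = a₁ ∷ a₂ ∷ a₃ ∷ a₄ ∷ a₆ ∷ ε ∷ w ∷ []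
  x₁ x₂ x₃ x₄ x₆ η ω β b₂ b₄ b₆ e v : Expr ℤ 7
  x₁ = Ι 0F
  x₂ = Ι 1F
  x₃ = Ι 2F
  x₄ = Ι 3F
  x₆ = Ι 4F
  η  = Ι 5F
  ω  = Ι 6F
  β  = η ⊕ κ 3 ⊗ ω
  b₂ = x₁ ⊗ x₁ ⊕ κ 4 ⊗ x₂
  b₄ = κ 2 ⊗ x₄ ⊕ x₁ ⊗ x₃
  b₆ = x₃ ⊗ x₃ ⊕ κ 4 ⊗ x₆
  e  = κ 2 ⊗ η ⊗ ω ⊕ κ 3 ⊗ ω ⊗ ω ⊖ κ 8 ⊗ b₄
  v  = κ 4 ⊗ η ⊗ b₄ ⊖ η ⊗ η ⊗ ω ⊖ κ 2 ⊗ η ⊗ ω ⊗ ω ⊖ ω ⊗ ω ⊗ ω ⊕ κ 4 ⊗ ω ⊗ b₄ ⊖ κ 8 ⊗ b₆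

-- The equations for c₄ and c₆ force a₄ and a₆.  Dividing by 3 and 27 is done by
-- 16 = 5 · 3 + 1 and 11 · 32 = 13 · 27 + 1, whence the coefficients of a₄ and a₆.
realise : ∀ {i j} → TwoAdic i j → ThreeAdic i j → ∃[ a₁ ] ∃[ a₂ ] ∃[ a₃ ] ∃[ a₄ ] ∃[ a₆ ]
  c₄ a₁ a₂ a₃ a₄ ≡ i × c₆ a₁ a₂ a₃ a₄ a₆ ≡ j
realise (even p q a ip jq) (threeAdic {ε} t e v ie jv) =
  -- Here b₂ = 4ε ≡ ε modulo 3, and a₃ = a accounts for the term 8a² of j.
  + 0 , ε , a , Ops.⟦ x₄ ⟧ ρ , Ops.⟦ x₆ ⟧ ρ ,
  trans (sym (⟦C₄⟧ (κ 0) η α x₄ ρ))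
    (trans (modulo (C₄ (κ 0) η α x₄) i
        (κ⁻ 16 ×[ i ≈ i′ ] ∷ []) refl ρ (trans (sym ip) ie ∷ []))
      (sym ip)) ,
  trans (sym (⟦C₆⟧ (κ 0) η α x₄ x₆ ρ))
    (trans (modulo (C₆ (κ 0) η α x₄ x₆) j
        (κ⁻ 352 ×[ j ≈ j′ ] ∷ (κ 1440 ⊗ η) ×[ i ≈ i′ ] ∷ κ 1376 ×[ η ⊗ η ⊗ η ≈ η ] ∷ [])
        refl ρ (trans (sym jq) jv ∷ trans (sym ip) ie ∷ trit-cube t ∷ []))
      (sym jq))
  where
  ρ : Vec ℤ 6
  ρ = ε ∷ p ∷ q ∷ e ∷ v ∷ a ∷ []
  η π θ χ ν α x₄ x₆ i i′ j j′ : Expr ℤ 6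
  η  = Ι 0F
  π  = Ι 1F
  θ  = Ι 2F
  χ  = Ι 3F
  ν  = Ι 4F
  α  = Ι 5F
  x₄ = κ 5 ⊗ π ⊖ χ
  x₆ = κ 2 ⊗ η ⊖ κ 25 ⊗ η ⊗ π ⊕ η ⊗ χ ⊕ κ 3 ⊗ α ⊗ α ⊖ κ 11 ⊗ ν ⊕ κ 13 ⊗ θ
  i  = κ 16 ⊗ π
  i′ = η ⊗ η ⊕ κ 3 ⊗ χ
  j  = κ 32 ⊗ θ ⊕ κ 8 ⊗ (α ⊗ α)
  j′ = κ 27 ⊗ ν ⊖ η ⊗ (κ 1 ⊖ κ 9 ⊗ χ)
realise (odd k n ik jn) (threeAdic {ε} t e v ie jv)
  -- The argument is the value of b₄ forced by c₄ when b₂ = 4ε - 3. As a₁ = 1 gives b₄ = 2a₄ + a₃,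
  -- remainder and quotient by 2 are a₃ and a₄.
  with residue 2 (ε * ε - + 3 * k + e - ε)
... | r , a₄ , parity =
  + 1 , ε - + 1 , + toℕ r , a₄ , Ops.⟦ x₆ ⟧ ρ ,
  trans (sym (⟦C₄⟧ (κ 1) (η ⊖ κ 1) x₃ x₄ ρ))
    (trans (modulo (C₄ (κ 1) (η ⊖ κ 1) x₃ x₄) i
        (κ 8 ×[ i ≈ i′ ] ∷ κ 24 ×[ b ≈ x₃ ⊕ κ 2 ⊗ x₄ ] ∷ [])
        refl ρ (trans (sym ik) ie ∷ parity ∷ []))
      (sym ik)) ,
  trans (sym (⟦C₆⟧ (κ 1) (η ⊖ κ 1) x₃ x₄ x₆ ρ))
    (trans (modulo (C₆ (κ 1) (η ⊖ κ 1) x₃ x₄ x₆) j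
        (κ⁻ 352 ×[ j ≈ j′ ]
          ∷ (κ 216 ⊗ η ⊗ η ⊕ κ 648 ⊗ χ ⊖ κ 432 ⊗ ξ ⊖ κ 324) ×[ i ≈ i′ ]
          ∷ κ 512 ×[ η ⊗ η ⊗ η ≈ η ]
          -- The terms a₄² + a₄a₃ of a₆ complete the square: a₃² + 4(a₄² + a₄a₃) = b₄². The cofactor
          -- therefore collects 216(b² - b₄²) and 36b₂(b₄ - b) with b₂ = 4ε - 3.
          ∷ (κ 216 ⊗ (κ 2 ⊗ x₄ ⊕ x₃ ⊕ b) ⊖ κ 36 ⊗ (κ 4 ⊗ η ⊖ κ 3)) ×[ b ≈ x₃ ⊕ κ 2 ⊗ x₄ ]
          ∷ [])
        refl ρ (trans (sym jn) jv ∷ trans (sym ik) ie ∷ trit-cube t ∷ parity ∷ []))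
      (sym jn))
  where
  ρ : Vec ℤ 7
  ρ = ε ∷ k ∷ n ∷ e ∷ v ∷ + toℕ r ∷ a₄ ∷ []
  η ξ μ χ ν x₃ x₄ x₆ b i i′ j j′ : Expr ℤ 7
  η  = Ι 0F
  ξ  = Ι 1F
  μ  = Ι 2F
  χ  = Ι 3F
  ν  = Ι 4F
  x₃ = Ι 5F
  x₄ = Ι 6F
  b  = η ⊗ η ⊖ κ 3 ⊗ ξ ⊕ χ ⊖ η
  x₆ = η ⊖ η ⊗ η ⊖ (η ⊕ κ 1) ⊗ (η ⊕ κ 1) ⊗ ξ ⊖ κ 8 ⊗ ξ ⊗ ξ ⊖ κ 6 ⊗ χ ⊗ ξ ⊖ κ 11 ⊗ ν
       ⊕ κ 13 ⊗ μ ⊕ η ⊗ η ⊗ χ ⊖ κ 3 ⊗ η ⊗ χ ⊖ κ 2 ⊗ χ ⊕ κ 2 ⊗ χ ⊗ χ ⊕ x₄ ⊗ x₄ ⊕ x₄ ⊗ x₃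
  i  = κ 1 ⊕ κ 8 ⊗ ξ
  i′ = η ⊗ η ⊕ κ 3 ⊗ χ
  j  = κ 32 ⊗ μ ⊖ (κ 1 ⊕ κ 12 ⊗ ξ ⊕ κ 24 ⊗ (ξ ⊗ ξ))
  j′ = κ 27 ⊗ ν ⊖ η ⊗ (κ 1 ⊖ κ 9 ⊗ χ)

-- The congruence conditions

mod-intro : ∀ {a} r m q → a ≡ r + m * q → a ≡ r [modℤ m ]
mod-intro r m q refl = ∣⇒∣ᵤ (divides q (lemma r m q))
  where
  lemma : ∀ r m q → r + m * q - r ≡ q * m
  lemma = solve-∀

mod-elim : ∀ a r m → a ≡ r [modℤ m ] → ∃[ q ] a ≡ r + m * q
mod-elim a r m m∣a-r with divides q eq ← ∣ᵤ⇒∣ m∣a-r =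
  q , trans (lemma a r) (cong (_+_ r) (trans eq (ℤₚ.*-comm q m)))
  where
  lemma : ∀ a r → a ≡ r + (a - r)
  lemma = solve-∀

-- For k = r + 8m the value −(1 + 12k + 24k²) modulo 32 depends on r only.
module OddClass (r c d : ℤ) (class : c + + 32 * d ≡ - (+ 1 + + 12 * r + + 24 * (r * r))) where

  private
    xr xc xd xm xl k : Expr ℤ 5
    xr = Ι 0F
    xc = Ι 1F
    xd = Ι 2F
    xm = Ι 3F
    xl = Ι 4F
    k  = xr ⊕ κ 8 ⊗ xm
    classes : Expr ℤ 5 → Multiple 5
    classes f = f ×[ xc ⊕ κ 32 ⊗ xd ≈ ⊝ (κ 1 ⊕ κ 12 ⊗ xr ⊕ κ 24 ⊗ (xr ⊗ xr)) ]

  intro : ∀ {i j} → i ≡ + 1 + + 8 * r [modℤ + 64 ] → j ≡ c [modℤ + 32 ] → TwoAdic i j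
  intro {i} {j} i≡ j≡
    with m , refl ← mod-elim i (+ 1 + + 8 * r) (+ 64) i≡ | l , refl ← mod-elim j c (+ 32) j≡ =
    odd (Ops.⟦ k ⟧ (ρ m l)) (Ops.⟦ n′ ⟧ (ρ m l))
      (modulo (κ 1 ⊕ κ 8 ⊗ xr ⊕ κ 64 ⊗ xm) (κ 1 ⊕ κ 8 ⊗ k) [] refl (ρ m l) [])
      (modulo (xc ⊕ κ 32 ⊗ xl) (κ 32 ⊗ n′ ⊖ (κ 1 ⊕ κ 12 ⊗ k ⊕ κ 24 ⊗ (k ⊗ k)))
        (classes (κ 1) ∷ []) refl (ρ m l) (class ∷ []))
    where
    ρ : ℤ → ℤ → Vec ℤ 5
    ρ m l = r ∷ c ∷ d ∷ m ∷ l ∷ []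
    n′ : Expr ℤ 5
    -- For k = r + 8m, 12k + 24k² exceeds 12r + 24r² by 32(3m + 12rm + 48m²).
    n′ = xl ⊕ κ 3 ⊗ xm ⊕ κ 12 ⊗ xr ⊗ xm ⊕ κ 48 ⊗ xm ⊗ xm ⊖ xd

  elim : ∀ {i j} m n → i ≡ + 1 + + 8 * (r + + 8 * m) →
         j ≡ + 32 * n - (+ 1 + + 12 * (r + + 8 * m) + + 24 * ((r + + 8 * m) * (r + + 8 * m))) →
         i ≡ + 1 + + 8 * r [modℤ + 64 ] × j ≡ c [modℤ + 32 ]
  elim m n i≡ j≡ =
    mod-intro (+ 1 + + 8 * r) (+ 64) m (trans i≡
      (modulo (κ 1 ⊕ κ 8 ⊗ k) (κ 1 ⊕ κ 8 ⊗ xr ⊕ κ 64 ⊗ xm) [] refl ρ [])) ,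
    mod-intro c (+ 32) (Ops.⟦ q ⟧ ρ) (trans j≡
      (modulo (κ 32 ⊗ xl ⊖ (κ 1 ⊕ κ 12 ⊗ k ⊕ κ 24 ⊗ (k ⊗ k))) (xc ⊕ κ 32 ⊗ q)
        (classes (κ⁻ 1) ∷ []) refl ρ (class ∷ [])))
    where
    ρ : Vec ℤ 5
    ρ = r ∷ c ∷ d ∷ m ∷ n ∷ []
    q : Expr ℤ 5
    q = xl ⊖ κ 3 ⊗ xm ⊖ κ 12 ⊗ xr ⊗ xm ⊖ κ 48 ⊗ xm ⊗ xm ⊕ xd

-- One instance for each residue r of k modulo 8. The second and third arguments are remainder and
-- quotient of -(1 + 12r + 24r²) by 32.
private
  module O₀ = OddClass (+ 0) (+ 31) (- + 1) refl
  module O₁ = OddClass (+ 1) (+ 27) (- + 2) refl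
  module O₂ = OddClass (+ 2) (+ 7) (- + 4) refl
  module O₃ = OddClass (+ 3) (+ 3) (- + 8) refl
  module O₄ = OddClass (+ 4) (+ 15) (- + 14) refl
  module O₅ = OddClass (+ 5) (+ 11) (- + 21) refl
  module O₆ = OddClass (+ 6) (+ 23) (- + 30) refl
  module O₇ = OddClass (+ 7) (+ 19) (- + 40) refl

cond2⇒twoAdic : ∀ {i j} → Cond2 i j → TwoAdic i j
cond2⇒twoAdic {i} {j} (inj₁ (i≡ , j≡))
  with p , ip ← mod-elim i (+ 0) (+ 16) i≡ | q , jq ← mod-elim j (+ 0) (+ 32) j≡ =
  even p q (+ 0) (trans ip (ℤₚ.+-identityˡ _)) (trans jq (ℤₚ.+-comm (+ 0) (+ 32 * q)))
cond2⇒twoAdic {i} {j} (inj₂ (inj₁ (i≡ , j≡)))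
  with p , ip ← mod-elim i (+ 0) (+ 16) i≡ | q , jq ← mod-elim j (+ 8) (+ 32) j≡ =
  even p q (+ 1) (trans ip (ℤₚ.+-identityˡ _)) (trans jq (ℤₚ.+-comm (+ 8) (+ 32 * q)))
cond2⇒twoAdic (inj₂ (inj₂ (inj₁ (i≡ , j≡)))) = O₀.intro i≡ j≡
cond2⇒twoAdic (inj₂ (inj₂ (inj₂ (inj₁ (i≡ , j≡))))) = O₁.intro i≡ j≡
cond2⇒twoAdic (inj₂ (inj₂ (inj₂ (inj₂ (inj₁ (i≡ , j≡)))))) = O₂.intro i≡ j≡
cond2⇒twoAdic (inj₂ (inj₂ (inj₂ (inj₂ (inj₂ (inj₁ (i≡ , j≡))))))) = O₃.intro i≡ j≡
cond2⇒twoAdic (inj₂ (inj₂ (inj₂ (inj₂ (inj₂ (inj₂ (inj₁ (i≡ , j≡)))))))) = O₄.intro i≡ j≡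
cond2⇒twoAdic (inj₂ (inj₂ (inj₂ (inj₂ (inj₂ (inj₂ (inj₂ (inj₁ (i≡ , j≡))))))))) = O₅.intro i≡ j≡
cond2⇒twoAdic (inj₂ (inj₂ (inj₂ (inj₂ (inj₂ (inj₂ (inj₂ (inj₂ (inj₁ (i≡ , j≡)))))))))) = O₆.intro i≡ j≡
cond2⇒twoAdic (inj₂ (inj₂ (inj₂ (inj₂ (inj₂ (inj₂ (inj₂ (inj₂ (inj₂ (i≡ , j≡)))))))))) = O₇.intro i≡ j≡

-- In the even case a² is 0 or 1 modulo 4 according to the parity of a, so 8a² is 0 or 8 modulo 32.
-- In the odd case the residue of k modulo 8 selects one of the eight classes.
twoAdic⇒cond2 : ∀ {i j} → TwoAdic i j → Cond2 i j
twoAdic⇒cond2 {i} {j} (even p q a ip jq) = by-parity (residue 2 a)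
  where
  i≡0 : i ≡ + 0 [modℤ + 16 ]
  i≡0 = mod-intro (+ 0) (+ 16) p (trans ip (sym (ℤₚ.+-identityˡ _)))
  xq xb : Expr ℤ 2
  xq = Ι 0F
  xb = Ι 1F
  by-parity : (∃[ r ] ∃[ b ] a ≡ + toℕ {2} r + + 2 * b) → Cond2 i j
  by-parity (0F , b , refl) = inj₁ (i≡0 , mod-intro (+ 0) (+ 32) (q + b * b) (trans jq
    (modulo (κ 32 ⊗ xq ⊕ κ 8 ⊗ ((κ 0 ⊕ κ 2 ⊗ xb) ⊗ (κ 0 ⊕ κ 2 ⊗ xb)))
      (κ 0 ⊕ κ 32 ⊗ (xq ⊕ xb ⊗ xb)) [] refl (q ∷ b ∷ []) [])))
  by-parity (1F , b , refl) = inj₂ (inj₁ (i≡0 , mod-intro (+ 8) (+ 32) (q + (b * b + b)) (trans jq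
    (modulo (κ 32 ⊗ xq ⊕ κ 8 ⊗ ((κ 1 ⊕ κ 2 ⊗ xb) ⊗ (κ 1 ⊕ κ 2 ⊗ xb)))
      (κ 8 ⊕ κ 32 ⊗ (xq ⊕ (xb ⊗ xb ⊕ xb))) [] refl (q ∷ b ∷ []) []))))
twoAdic⇒cond2 (odd k n ik jn) with residue 8 k
... | 0F , m , refl = inj₂ (inj₂ (inj₁ (O₀.elim m n ik jn)))
... | 1F , m , refl = inj₂ (inj₂ (inj₂ (inj₁ (O₁.elim m n ik jn))))
... | 2F , m , refl = inj₂ (inj₂ (inj₂ (inj₂ (inj₁ (O₂.elim m n ik jn)))))
... | 3F , m , refl = inj₂ (inj₂ (inj₂ (inj₂ (inj₂ (inj₁ (O₃.elim m n ik jn))))))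
... | 4F , m , refl = inj₂ (inj₂ (inj₂ (inj₂ (inj₂ (inj₂ (inj₁ (O₄.elim m n ik jn)))))))
... | 5F , m , refl = inj₂ (inj₂ (inj₂ (inj₂ (inj₂ (inj₂ (inj₂ (inj₁ (O₅.elim m n ik jn))))))))
... | 6F , m , refl = inj₂ (inj₂ (inj₂ (inj₂ (inj₂ (inj₂ (inj₂ (inj₂ (inj₁ (O₆.elim m n ik jn)))))))))
... | 7F , m , refl = inj₂ (inj₂ (inj₂ (inj₂ (inj₂ (inj₂ (inj₂ (inj₂ (inj₂ (O₇.elim m n ik jn)))))))))

-- Congruences over ℤ localised at 3

coprime-* : ∀ {a b n} → Coprime a n → Coprime b n → Coprime (a ℕ.* b) n
coprime-* {a} {b} {n} a⊥n b⊥n {d} (d∣ab , d∣n) =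
  b⊥n (Coprimality.coprime-divisor d⊥a d∣ab , d∣n)
  where
  d⊥a : Coprime d a
  d⊥a (c∣d , c∣a) = a⊥n (c∣a , ℕDiv.∣-trans c∣d d∣n)

3∤⇒coprime : ∀ {n} → ¬ (3 ℕDiv.∣ n) → Coprime 3 n
3∤⇒coprime 3∤n (d∣3 , d∣n) with prime⇒irreducible (from-yes (prime? 3)) d∣3
... | inj₁ d≡1 = d≡1
... | inj₂ refl = ⊥-elim (3∤n d∣n)

-- Reduction to lowest terms only cancels a factor: the reduced denominator times gcd(k, d) is d.
inZ3-/ : ∀ k d .{{_ : ℕ.NonZero d}} → ¬ (3 ℕDiv.∣ d) → InZ3 (k / d)
inZ3-/ k d 3∤d 3∣↧ = 3∤d (ℕDiv.∣-trans 3∣↧ (∣⇒∣ᵤ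
  (divides (gcd k (+ d)) (sym (trans (ℤₚ.*-comm (gcd k (+ d)) (ℚ.↧ (k / d))) (ℚₚ.↧-/ k d))))))

-- Rational equations are checked on unnormalised fractions, where equality is cross multiplication
-- and no gcd occurs.
toℚᵘ-/ : ∀ i d → ℚ.toℚᵘ (i / suc d) ℚᵘ.≃ mkℚᵘ i d
toℚᵘ-/ i d = ℚₚ.toℚᵘ-fromℚᵘ (mkℚᵘ i d)

toℚᵘ-difference : ∀ i d r → ℚ.toℚᵘ (i / suc d ℚ.- ℤ→ℚ r) ℚᵘ.≃ mkℚᵘ (i - + suc d * r) d
toℚᵘ-difference i d r = begin
  ℚ.toℚᵘ (i / suc d ℚ.- ℤ→ℚ r)                      ≈⟨ ℚₚ.toℚᵘ-homo-+ (i / suc d) (ℚ.- ℤ→ℚ r) ⟩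
  ℚ.toℚᵘ (i / suc d) ℚᵘ.+ ℚ.toℚᵘ (ℚ.- ℤ→ℚ r)        ≈⟨ ℚᵘₚ.+-cong (toℚᵘ-/ i d) (ℚₚ.toℚᵘ-homo‿- (ℤ→ℚ r)) ⟩
  mkℚᵘ i d ℚᵘ.+ ℚᵘ.- ℚ.toℚᵘ (ℤ→ℚ r)                 ≈⟨ ℚᵘₚ.+-congʳ (mkℚᵘ i d) (ℚᵘₚ.-‿cong (toℚᵘ-/ r 0)) ⟩
  mkℚᵘ i d ℚᵘ.+ ℚᵘ.- mkℚᵘ r 0                       ≈⟨ *≡* (cong₂ _*_ (lemma i (+ suc d) r) (cong (λ n → + suc n) (sym (ℕₚ.*-identityʳ d)))) ⟩
  mkℚᵘ (i - + suc d * r) d                          ∎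
  where
  open ℚᵘₚ.≃-Reasoning
  lemma : ∀ i D r → i * + 1 + - r * D ≡ i - D * r
  lemma = solve-∀

-- With D = `suc d`, i/D - r = m · (k/D), and k/D is 3-integral because 3 does not divide D.
mod₃-intro : ∀ {i d r m} k → ¬ (3 ℕDiv.∣ suc d) → i ≡ + suc d * r + m * k →
             (i / suc d) ≡ ℤ→ℚ r [modℤ₍₃₎ m ]
mod₃-intro {i} {d} {r} {m} k 3∤d eq = k / suc d , inZ3-/ k (suc d) 3∤d ,
  ℚₚ.toℚᵘ-injective (begin
    ℚ.toℚᵘ (i / suc d ℚ.- ℤ→ℚ r)            ≈⟨ toℚᵘ-difference i d r ⟩
    mkℚᵘ (i - + suc d * r) d                ≈⟨ *≡* (cong₂ _*_ numerators (cong (λ n → + suc n) (ℕₚ.+-identityʳ d))) ⟩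
    mkℚᵘ m 0 ℚᵘ.* mkℚᵘ k d                  ≈⟨ ℚᵘₚ.*-cong (toℚᵘ-/ m 0) (toℚᵘ-/ k d) ⟨
    ℚ.toℚᵘ (m / 1) ℚᵘ.* ℚ.toℚᵘ (k / suc d)  ≈⟨ ℚₚ.toℚᵘ-homo-* (m / 1) (k / suc d) ⟨
    ℚ.toℚᵘ ((m / 1) ℚ.* (k / suc d))        ∎)
  where
  open ℚᵘₚ.≃-Reasoning
  lemma : ∀ D r mk → D * r + mk - D * r ≡ mk
  lemma = solve-∀
  numerators : i - + suc d * r ≡ m * k
  numerators = trans (cong (_- + suc d * r) eq) (lemma (+ suc d) r (m * k))

-- Clearing denominators in i/D - r = m · a/b gives b(i - Dr) = aDm; b is prime to 3, hence to m, so
-- m divides i - Dr. Coprimality is assumed for every n prime to 3 because b is only known after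
-- unpacking u.
mod₃-elim : ∀ {i d r m} → (∀ {n} → ¬ (3 ℕDiv.∣ n) → Coprime ∣ m ∣ n) →
            (i / suc d) ≡ ℤ→ℚ r [modℤ₍₃₎ m ] → ∃[ k ] i ≡ + suc d * r + m * k
mod₃-elim {i} {d} {r} {m} m⊥ (u@(ℚ.mkℚ a b _) , 3∤↧u , eq) =
  mod-elim i (+ suc d * r) m
    (coprime-divisor m (+ suc b) (i - + suc d * r) (m⊥ 3∤↧u)
      (∣⇒∣ᵤ (divides (a * + suc d) (cross equation))))
  where
  open ℚᵘₚ.≃-Reasoning
  equation : mkℚᵘ (i - + suc d * r) d ℚᵘ.≃ mkℚᵘ m 0 ℚᵘ.* mkℚᵘ a b
  equation = begin
    mkℚᵘ (i - + suc d * r) d        ≈⟨ toℚᵘ-difference i d r ⟨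
    ℚ.toℚᵘ (i / suc d ℚ.- ℤ→ℚ r)    ≈⟨ ℚᵘₚ.≃-reflexive (cong ℚ.toℚᵘ eq) ⟩
    ℚ.toℚᵘ ((m / 1) ℚ.* u)          ≈⟨ ℚₚ.toℚᵘ-homo-* (m / 1) u ⟩
    ℚ.toℚᵘ (m / 1) ℚᵘ.* mkℚᵘ a b    ≈⟨ ℚᵘₚ.*-congʳ (toℚᵘ-/ m 0) ⟩
    mkℚᵘ m 0 ℚᵘ.* mkℚᵘ a b          ∎
  lemma : ∀ m a D → m * a * D ≡ a * D * m
  lemma = solve-∀
  cross : mkℚᵘ (i - + suc d * r) d ℚᵘ.≃ mkℚᵘ m 0 ℚᵘ.* mkℚᵘ a b →
          + suc b * (i - + suc d * r) ≡ a * + suc d * m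
  cross (*≡* eq) = trans (ℤₚ.*-comm (+ suc b) _)
    (trans (cong (λ n → (i - + suc d * r) * + suc n) (sym (ℕₚ.+-identityʳ b)))
    (trans eq (lemma m a (+ suc d))))

-- The 3-adic conditions on I and J

private
  3∤16 : ¬ (3 ℕDiv.∣ 16)
  3∤16 = from-no (3 ℕDiv.∣? 16)

  3∤32 : ¬ (3 ℕDiv.∣ 32)
  3∤32 = from-no (3 ℕDiv.∣? 32)

3∤⇒coprime-9 : ∀ {n} → ¬ (3 ℕDiv.∣ n) → Coprime 9 n
3∤⇒coprime-9 3∤n = coprime-* (3∤⇒coprime 3∤n) (3∤⇒coprime 3∤n)

3∤⇒coprime-27 : ∀ {n} → ¬ (3 ℕDiv.∣ n) → Coprime 27 n
3∤⇒coprime-27 3∤n = coprime-* (3∤⇒coprime 3∤n) (3∤⇒coprime-9 3∤n)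

-- For ε = ±1 the residues of (I, J) modulo (9, 27) depend only on ε and e modulo 3.
module UnitClass (ε R S f g : ℤ) (class-I : + 16 * R ≡ ε * ε + + 3 * f)
                 (class-J : + 32 * S ≡ + 27 * g - ε * (+ 1 - + 9 * f)) where

  private
    η ρ σ φ γ x y i-class : Expr ℤ 7
    η = Ι 0F
    ρ = Ι 1F
    σ = Ι 2F
    φ = Ι 3F
    γ = Ι 4F
    x = Ι 5F
    y = Ι 6F
    env : ℤ → ℤ → Vec ℤ 7
    env k l = ε ∷ R ∷ S ∷ f ∷ g ∷ k ∷ l ∷ []
    i-class = η ⊗ η ⊕ κ 3 ⊗ (φ ⊕ κ 3 ⊗ x)
    j-class : Expr ℤ 7 → Expr ℤ 7
    j-class v = κ 27 ⊗ v ⊖ η ⊗ (κ 1 ⊖ κ 9 ⊗ (φ ⊕ κ 3 ⊗ x))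
    relation-I relation-J : Expr ℤ 7 → Multiple 7
    relation-I c = c ×[ κ 16 ⊗ ρ ≈ η ⊗ η ⊕ κ 3 ⊗ φ ]
    relation-J c = c ×[ κ 32 ⊗ σ ≈ κ 27 ⊗ γ ⊖ η ⊗ (κ 1 ⊖ κ 9 ⊗ φ) ]

  intro : ∀ {i j} → Trit ε → (i / 16) ≡ ℤ→ℚ R [modℤ₍₃₎ + 9 ] →
          (j / 32) ≡ ℤ→ℚ S [modℤ₍₃₎ + 27 ] → ThreeAdic i j
  intro {i} {j} t I≡ J≡
    with k , ik ← mod₃-elim {i} {15} {R} {+ 9} 3∤⇒coprime-9 I≡
       | l , jl ← mod₃-elim {j} {31} {S} {+ 27} 3∤⇒coprime-27 J≡ =
    -- Raising e by 3k changes -ε(1 - 9e) by 27εk, which the coefficient of 27 absorbs.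
    threeAdic t (f + + 3 * k) (l - ε * k + g)
      (trans ik (modulo (κ 16 ⊗ ρ ⊕ κ 9 ⊗ x) i-class
        (relation-I (κ 1) ∷ []) refl (env k l) (class-I ∷ [])))
      (trans jl (modulo (κ 32 ⊗ σ ⊕ κ 27 ⊗ y) (j-class (y ⊖ η ⊗ x ⊕ γ))
        (relation-J (κ 1) ∷ []) refl (env k l) (class-J ∷ [])))

  elim : ∀ {i j e} k v → e ≡ f + + 3 * k → i ≡ ε * ε + + 3 * e →
         j ≡ + 27 * v - ε * (+ 1 - + 9 * e) →
         (i / 16) ≡ ℤ→ℚ R [modℤ₍₃₎ + 9 ] × (j / 32) ≡ ℤ→ℚ S [modℤ₍₃₎ + 27 ]
  elim {i} {j} k v refl i≡ j≡ =
    mod₃-intro {i} {15} {R} {+ 9} k 3∤16 (trans i≡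
      (modulo i-class (κ 16 ⊗ ρ ⊕ κ 9 ⊗ x)
        (relation-I (κ⁻ 1) ∷ []) refl (env k v) (class-I ∷ []))) ,
    mod₃-intro {j} {31} {S} {+ 27} (v + ε * k - g) 3∤32 (trans j≡
      (modulo (j-class y) (κ 32 ⊗ σ ⊕ κ 27 ⊗ (y ⊕ η ⊗ x ⊖ γ))
        (relation-J (κ⁻ 1) ∷ []) refl (env k v) (class-J ∷ [])))

-- Here f = (16R - 1)/3. Modulo 3 the second equation reads -S ≡ -ε, so ε is the symmetric residue
-- of S; then g is determined.
private
  module U₁⁺ = UnitClass (- + 1) (+ 1) (+ 2) (+ 5) (+ 4) refl refl
  module U₁⁻ = UnitClass (+ 1) (+ 1) (- + 2) (+ 5) (- + 4) refl refl
  module U₄⁺ = UnitClass (+ 1) (+ 4) (+ 16) (+ 21) (+ 12) refl refl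
  module U₄⁻ = UnitClass (- + 1) (+ 4) (- + 16) (+ 21) (- + 12) refl refl
  module U₇⁺ = UnitClass (+ 1) (+ 7) (+ 7) (+ 37) (- + 4) refl refl
  module U₇⁻ = UnitClass (- + 1) (+ 7) (- + 7) (+ 37) (+ 4) refl refl

cond3⇒threeAdic : ∀ {i j} → Cond3 (i / 16) (j / 32) → ThreeAdic i j
cond3⇒threeAdic {i} {j} (inj₁ (I≡ , J≡))
  with e , ie ← mod₃-elim {i} {15} {+ 0} {+ 3} 3∤⇒coprime I≡
     | v , jv ← mod₃-elim {j} {31} {+ 0} {+ 27} 3∤⇒coprime-27 J≡ =
  -- For ε = 0 the term ε(1 - 9e) evaluates to 0, leaving only the order of the summands to adjust.
  threeAdic zeroᵗ e v ie (trans jv (ℤₚ.+-comm (+ 0) (+ 27 * v)))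
cond3⇒threeAdic (inj₂ (inj₁ (I≡ , inj₁ J≡))) = U₁⁺.intro negᵗ I≡ J≡
cond3⇒threeAdic (inj₂ (inj₁ (I≡ , inj₂ J≡))) = U₁⁻.intro oneᵗ I≡ J≡
cond3⇒threeAdic (inj₂ (inj₂ (inj₁ (I≡ , inj₁ J≡)))) = U₄⁺.intro oneᵗ I≡ J≡
cond3⇒threeAdic (inj₂ (inj₂ (inj₁ (I≡ , inj₂ J≡)))) = U₄⁻.intro negᵗ I≡ J≡
cond3⇒threeAdic (inj₂ (inj₂ (inj₂ (I≡ , inj₁ J≡)))) = U₇⁺.intro oneᵗ I≡ J≡
cond3⇒threeAdic (inj₂ (inj₂ (inj₂ (I≡ , inj₂ J≡)))) = U₇⁻.intro negᵗ I≡ J≡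

-- The instances of `UnitClass` with R = 4, 7, 1 represent the residues 0, 1, 2 of e modulo 3 by f =
-- 21, 37, 5.
private
  lift₀ : ∀ m → + 0 + + 3 * m ≡ + 21 + + 3 * (m - + 7)
  lift₀ m = modulo (κ 0 ⊕ κ 3 ⊗ Ι 0F) (κ 21 ⊕ κ 3 ⊗ (Ι 0F ⊖ κ 7)) [] refl (m ∷ []) []

  lift₁ : ∀ m → + 1 + + 3 * m ≡ + 37 + + 3 * (m - + 12)
  lift₁ m = modulo (κ 1 ⊕ κ 3 ⊗ Ι 0F) (κ 37 ⊕ κ 3 ⊗ (Ι 0F ⊖ κ 12)) [] refl (m ∷ []) []

  lift₂ : ∀ m → + 2 + + 3 * m ≡ + 5 + + 3 * (m - + 1)
  lift₂ m = modulo (κ 2 ⊕ κ 3 ⊗ Ι 0F) (κ 5 ⊕ κ 3 ⊗ (Ι 0F ⊖ κ 1)) [] refl (m ∷ []) []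

threeAdic⇒cond3 : ∀ {i j} → ThreeAdic i j → Cond3 (i / 16) (j / 32)
threeAdic⇒cond3 {i} {j} (threeAdic zeroᵗ e v ie jv) = inj₁
  ( mod₃-intro {i} {15} {+ 0} {+ 3} e 3∤16 ie
  , mod₃-intro {j} {31} {+ 0} {+ 27} v 3∤32 (trans jv (ℤₚ.+-comm (+ 27 * v) (+ 0))))
threeAdic⇒cond3 {i} {j} (threeAdic oneᵗ e v ie jv) = by-residue (residue 3 e)
  where
  by-residue : (∃[ r ] ∃[ m ] e ≡ + toℕ {3} r + + 3 * m) → Cond3 (i / 16) (j / 32)
  by-residue (0F , m , eq) with I≡ , J≡ ← U₄⁺.elim (m - + 7) v (trans eq (lift₀ m)) ie jv =
    inj₂ (inj₂ (inj₁ (I≡ , inj₁ J≡)))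
  by-residue (1F , m , eq) with I≡ , J≡ ← U₇⁺.elim (m - + 12) v (trans eq (lift₁ m)) ie jv =
    inj₂ (inj₂ (inj₂ (I≡ , inj₁ J≡)))
  by-residue (2F , m , eq) with I≡ , J≡ ← U₁⁻.elim (m - + 1) v (trans eq (lift₂ m)) ie jv =
    inj₂ (inj₁ (I≡ , inj₂ J≡))
threeAdic⇒cond3 {i} {j} (threeAdic negᵗ e v ie jv) = by-residue (residue 3 e)
  where
  by-residue : (∃[ r ] ∃[ m ] e ≡ + toℕ {3} r + + 3 * m) → Cond3 (i / 16) (j / 32)
  by-residue (0F , m , eq) with I≡ , J≡ ← U₄⁻.elim (m - + 7) v (trans eq (lift₀ m)) ie jv =
    inj₂ (inj₂ (inj₁ (I≡ , inj₂ J≡)))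
  by-residue (1F , m , eq) with I≡ , J≡ ← U₇⁻.elim (m - + 12) v (trans eq (lift₁ m)) ie jv =
    inj₂ (inj₂ (inj₂ (I≡ , inj₂ J≡)))
  by-residue (2F , m , eq) with I≡ , J≡ ← U₁⁺.elim (m - + 1) v (trans eq (lift₂ m)) ie jv =
    inj₂ (inj₁ (I≡ , inj₁ J≡))

-- The equivalence

Conditions : ℚ → ℚ → Set
Conditions I J = (Σ ℤ λ i → Σ ℤ λ j → I ≡ i / 16 × J ≡ j / 32 × Cond2 i j) × Cond3 I J

-- The equations i ≡ c₄, j ≡ c₆ keep the large polynomials of Defs out of the goals.
weierstrass⇒conditions : ∀ {i j} → (∃[ a₁ ] ∃[ a₂ ] ∃[ a₃ ] ∃[ a₄ ] ∃[ a₆ ]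
  i ≡ c₄ a₁ a₂ a₃ a₄ × j ≡ c₆ a₁ a₂ a₃ a₄ a₆) → Conditions (i / 16) (j / 32)
weierstrass⇒conditions (a₁ , a₂ , a₃ , a₄ , a₆ , refl , refl) =
  (c₄ a₁ a₂ a₃ a₄ , c₆ a₁ a₂ a₃ a₄ a₆ , refl , refl ,
    twoAdic⇒cond2 (weierstrass-twoAdic a₁ a₂ a₃ a₄ a₆)) ,
  threeAdic⇒cond3 (weierstrass-threeAdic a₁ a₂ a₃ a₄ a₆)

weierstrass⇒invariants : ∀ {i j} → (∃[ a₁ ] ∃[ a₂ ] ∃[ a₃ ] ∃[ a₄ ] ∃[ a₆ ]
  c₄ a₁ a₂ a₃ a₄ ≡ i × c₆ a₁ a₂ a₃ a₄ a₆ ≡ j) → ∃[ f ] (invI f ≡ i / 16 × invJ f ≡ j / 32)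
weierstrass⇒invariants (a₁ , a₂ , a₃ , a₄ , a₆ , i≡ , j≡) =
  weierstrassCubic a₁ a₂ a₃ a₄ a₆ ,
  cong (λ i → i / 16) (trans (sixteenI-weierstrassCubic a₁ a₂ a₃ a₄ a₆) i≡) ,
  cong (λ j → j / 32) (trans (thirtytwoJ-weierstrassCubic a₁ a₂ a₃ a₄ a₆) j≡)

theorem1p9 : (I J : ℚ) →
    (∃[ f ] (invI f ≡ I × invJ f ≡ J))
    ⇔ ((Σ ℤ λ i → Σ ℤ λ j → I ≡ i / 16 × J ≡ j / 32 × Cond2 i j) × Cond3 I J)
theorem1p9 I J = mk⇔ necessity sufficiency
  where
  necessity : (∃[ f ] (invI f ≡ I × invJ f ≡ J)) → Conditions I J
  necessity (f , I≡ , J≡) = subst₂ Conditions I≡ J≡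
    (weierstrass⇒conditions (sixteenI-thirtytwoJ-weierstrass f))

  sufficiency : Conditions I J → ∃[ f ] (invI f ≡ I × invJ f ≡ J)
  sufficiency ((i , j , refl , refl , cond2) , cond3) =
    weierstrass⇒invariants (realise (cond2⇒twoAdic {i} {j} cond2) (cond3⇒threeAdic cond3))
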